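{- Some properties of distributions on $[n]$ require $\Omega(n)$ conditional samples to test (adaptively or not). That is, there exist constants $\epsilon>0$, $c>0$ and, for every $n$, a set $\mathcal P_n$ of distributions over $[n]$, such that for all sufficiently large $n$ every (adaptive or non-adaptive) distribution tester for $\mathcal P_n$, with distance parameter $\epsilon$ and error bound $\delta=\frac13$, must use at least $cn$ conditional samples.
   Context: $[n]=\{1,\ldots,n\}$; the variation distance is $d(\mu,\mu')=\frac12\sum_{i=1}^n|\mu(i)-\mu'(i)|$. A property is a set of distributions over $[n]$ (not required to be invariant under permutations of $[n]$). $\mu$ is $\epsilon$-far from $\mathcal P$ if $d(\mu,\mu')\ge\epsilon$ for every $\mu'\in\mathcal P$. A conditional sampling oracle for $\mu$ takes a nonempty set $A\subseteq[n]$ and returns $j\in A$ with probability $\mu(j)/\mu(A)$ if $\mu(A)>0$, and a uniformly random member of $A$ if $\mu(A)=0$, independently of all previous samples. An adaptive distribution tester for $\mathcal P$ is a randomized algorithm that in each phase chooses a conditioning set based on the previously received samples and its internal coin tosses and receives the oracle's answer, and finally accepts or rejects; it must accept with probability at least $1-\delta$ if $\mu\in\mathcal P$ and reject with probability at least $1-\delta$ if $\mu$ is $\epsilon$-far from $\mathcal P$. A non-adaptive tester is one that fixes all conditioning sets before receiving any sample. -}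

module Defs where

open import Algebra.Bundles.Raw using (RawMonoid)
import Algebra.Definitions.RawMonoid as RawMonoidDefinitions
open import Data.Bool.Base using (Bool; true; false; if_then_else_)
import Data.Bool.Properties as Bool
open import Data.Fin.Base using (Fin)
open import Data.Fin.Subset using (Subset; Nonempty; _∈_; _∉_; ∣_∣)
import Data.Integer.Base as ℤ
open import Data.Nat.Base as ℕ using (ℕ; suc)
import Data.Nat.Properties as ℕ
open import Data.Product.Base using (Σ; ∃; _×_; _,_)
open import Data.Rational.Base as ℚ using (ℚ; 0ℚ; 1ℚ; ½)
import Data.Rational.Properties as ℚ
open import Data.Rational.Solver using (module +-*-Solver)
open import Data.Sum.Base using (_⊎_; inj₁; inj₂)
open import Data.Vec.Base as Vec using (Vec; []; _∷_; lookup)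
open import Level using (0ℓ) renaming (suc to lsuc)
open import Relation.Binary.Core using (Rel)
open import Relation.Binary.Definitions using (_Respects_)
open import Relation.Binary.PropositionalEquality using (_≡_; refl; sym; trans; cong; subst)
open import Relation.Nullary.Decidable using (does)
open import Relation.Unary using (Pred)

-- Real numbers are Cauchy sequences of rationals, compared up to _≃_.

Eventually : Pred ℕ 0ℓ → Set
Eventually P = ∃ λ N → ∀ n → N ℕ.≤ n → P n

Cauchy : (ℕ → ℚ) → Set
Cauchy x = ∀ ε → 0ℚ ℚ.< ε →
           ∃ λ N → ∀ m n → N ℕ.≤ m → N ℕ.≤ n → ℚ.∣ x m ℚ.- x n ∣ ℚ.< ε

record ℝ : Set where
  constructor mkℝ
  field
    seq    : ℕ → ℚ
    cauchy : Cauchy seq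

open ℝ public

module CauchyProperties where

  abstract

    0<½ε : ∀ {ε} → 0ℚ ℚ.< ε → 0ℚ ℚ.< ½ ℚ.* ε
    0<½ε 0<ε = ℚ.*-monoʳ-<-pos ½ 0<ε

    ½ε+½ε≡ε : ∀ ε → ½ ℚ.* ε ℚ.+ ½ ℚ.* ε ≡ ε
    ½ε+½ε≡ε ε = trans (sym (ℚ.*-distribʳ-+ ε ½ ½)) (ℚ.*-identityˡ ε)

    const-cauchy : ∀ p → Cauchy (λ _ → p)
    const-cauchy p ε 0<ε = 0 , λ _ _ _ _ →
      subst (λ d → ℚ.∣ d ∣ ℚ.< ε) (sym (ℚ.+-inverseʳ p)) 0<ε

    +-cauchy : ∀ {x y} → Cauchy x → Cauchy y → Cauchy (λ n → x n ℚ.+ y n)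
    +-cauchy {x} {y} cx cy ε 0<ε with cx _ (0<½ε 0<ε) | cy _ (0<½ε 0<ε)
    ... | M , hx | N , hy = M ℕ.⊔ N , bound
      where
      rearrange : ∀ a b c d → (a ℚ.+ b) ℚ.- (c ℚ.+ d) ≡ (a ℚ.- c) ℚ.+ (b ℚ.- d)
      rearrange = solve 4 (λ a b c d → (a :+ b) :- (c :+ d) := (a :- c) :+ (b :- d)) refl
        where open +-*-Solver
      open ℚ.≤-Reasoning
      bound : ∀ m n → M ℕ.⊔ N ℕ.≤ m → M ℕ.⊔ N ℕ.≤ n →
              ℚ.∣ (x m ℚ.+ y m) ℚ.- (x n ℚ.+ y n) ∣ ℚ.< ε
      bound m n p q = begin-strict
        ℚ.∣ (x m ℚ.+ y m) ℚ.- (x n ℚ.+ y n) ∣       ≡⟨ cong ℚ.∣_∣ (rearrange (x m) (y m) (x n) (y n)) ⟩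
        ℚ.∣ (x m ℚ.- x n) ℚ.+ (y m ℚ.- y n) ∣       ≤⟨ ℚ.∣p+q∣≤∣p∣+∣q∣ (x m ℚ.- x n) (y m ℚ.- y n) ⟩
        ℚ.∣ x m ℚ.- x n ∣ ℚ.+ ℚ.∣ y m ℚ.- y n ∣     <⟨ ℚ.+-mono-<
                                                        (hx m n (ℕ.m⊔n≤o⇒m≤o M N p) (ℕ.m⊔n≤o⇒m≤o M N q))
                                                        (hy m n (ℕ.m⊔n≤o⇒n≤o M N p) (ℕ.m⊔n≤o⇒n≤o M N q)) ⟩
        ½ ℚ.* ε ℚ.+ ½ ℚ.* ε                         ≡⟨ ½ε+½ε≡ε ε ⟩
        ε                                           ∎

    neg-cauchy : ∀ {x} → Cauchy x → Cauchy (λ n → ℚ.- x n)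
    neg-cauchy {x} cx ε 0<ε with cx ε 0<ε
    ... | N , hx = N , λ m n p q →
      subst (ℚ._< ε) (sym (trans (cong ℚ.∣_∣ (rearrange (x m) (x n))) (ℚ.∣-p∣≡∣p∣ (x m ℚ.- x n)))) (hx m n p q)
      where
      rearrange : ∀ a b → (ℚ.- a) ℚ.- (ℚ.- b) ≡ ℚ.- (a ℚ.- b)
      rearrange = solve 2 (λ a b → (:- a) :- (:- b) := :- (a :- b)) refl
        where open +-*-Solver

    ∣p∣≤∣p-q∣+∣q∣ : ∀ p q → ℚ.∣ p ∣ ℚ.≤ ℚ.∣ p ℚ.- q ∣ ℚ.+ ℚ.∣ q ∣
    ∣p∣≤∣p-q∣+∣q∣ p q = begin
      ℚ.∣ p ∣                         ≡⟨ cong ℚ.∣_∣ (split p q) ⟩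
      ℚ.∣ (p ℚ.- q) ℚ.+ q ∣           ≤⟨ ℚ.∣p+q∣≤∣p∣+∣q∣ (p ℚ.- q) q ⟩
      ℚ.∣ p ℚ.- q ∣ ℚ.+ ℚ.∣ q ∣       ∎
      where
      open ℚ.≤-Reasoning
      split : ∀ a b → a ≡ (a ℚ.- b) ℚ.+ b
      split = solve 2 (λ a b → a := (a :- b) :+ b) refl
        where open +-*-Solver

    ∣∣p∣-∣q∣∣≤∣p-q∣ : ∀ p q → ℚ.∣ ℚ.∣ p ∣ ℚ.- ℚ.∣ q ∣ ∣ ℚ.≤ ℚ.∣ p ℚ.- q ∣
    ∣∣p∣-∣q∣∣≤∣p-q∣ p q = helper (ℚ.∣p∣≡p∨∣p∣≡-p (ℚ.∣ p ∣ ℚ.- ℚ.∣ q ∣))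
      where
      open ℚ.≤-Reasoning
      cancel : ∀ a b → (a ℚ.+ b) ℚ.- b ≡ a
      cancel = solve 2 (λ a b → (a :+ b) :- b := a) refl
        where open +-*-Solver
      flip : ∀ a b → ℚ.- (a ℚ.- b) ≡ b ℚ.- a
      flip = solve 2 (λ a b → :- (a :- b) := b :- a) refl
        where open +-*-Solver
      one-sided : ∀ a b → ℚ.∣ a ∣ ℚ.- ℚ.∣ b ∣ ℚ.≤ ℚ.∣ a ℚ.- b ∣
      one-sided a b = subst (ℚ.∣ a ∣ ℚ.- ℚ.∣ b ∣ ℚ.≤_) (cancel ℚ.∣ a ℚ.- b ∣ ℚ.∣ b ∣)
                        (ℚ.+-monoˡ-≤ (ℚ.- ℚ.∣ b ∣) (∣p∣≤∣p-q∣+∣q∣ a b))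
      helper : ∀ {r} → r ≡ ℚ.∣ p ∣ ℚ.- ℚ.∣ q ∣ ⊎ r ≡ ℚ.- (ℚ.∣ p ∣ ℚ.- ℚ.∣ q ∣) →
               r ℚ.≤ ℚ.∣ p ℚ.- q ∣
      helper (inj₁ refl) = one-sided p q
      helper (inj₂ refl) = begin
        ℚ.- (ℚ.∣ p ∣ ℚ.- ℚ.∣ q ∣)   ≡⟨ flip ℚ.∣ p ∣ ℚ.∣ q ∣ ⟩
        ℚ.∣ q ∣ ℚ.- ℚ.∣ p ∣         ≤⟨ one-sided q p ⟩
        ℚ.∣ q ℚ.- p ∣               ≡⟨ cong ℚ.∣_∣ (sym (flip p q)) ⟩
        ℚ.∣ ℚ.- (p ℚ.- q) ∣         ≡⟨ ℚ.∣-p∣≡∣p∣ (p ℚ.- q) ⟩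
        ℚ.∣ p ℚ.- q ∣               ∎

    abs-cauchy : ∀ {x} → Cauchy x → Cauchy (λ n → ℚ.∣ x n ∣)
    abs-cauchy {x} cx ε 0<ε with cx ε 0<ε
    ... | N , hx = N , λ m n p q → ℚ.≤-<-trans (∣∣p∣-∣q∣∣≤∣p-q∣ (x m) (x n)) (hx m n p q)

    cauchy⇒bounded : ∀ {x} → Cauchy x →
                     ∃ λ B → ℚ.Positive B × Eventually λ n → ℚ.∣ x n ∣ ℚ.≤ B
    cauchy⇒bounded {x} cx with cx 1ℚ (ℚ.positive⁻¹ 1ℚ)
    ... | N , h = 1ℚ ℚ.+ ℚ.∣ x N ∣
                , ℚ.pos+nonNeg⇒pos 1ℚ ℚ.∣ x N ∣ {{ℚ.∣-∣-nonNeg (x N)}}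
                , N , λ n p → ℚ.≤-trans (∣p∣≤∣p-q∣+∣q∣ (x n) (x N))
                                (ℚ.+-monoˡ-≤ ℚ.∣ x N ∣ (ℚ.<⇒≤ (h n N p ℕ.≤-refl)))

    rescale : ∀ K → ℚ.Positive K → ∀ ε → 0ℚ ℚ.< ε →
              ∃ λ η → 0ℚ ℚ.< η × K ℚ.* η ≡ ε
    rescale K K>0 ε 0<ε = η , 0<η , K*η≡ε
      where
      K⁻¹ η : ℚ
      K⁻¹ = (ℚ.1/ K) {{ℚ.pos⇒nonZero K {{K>0}}}}
      η   = K⁻¹ ℚ.* ε
      0<η : 0ℚ ℚ.< η
      0<η = ℚ.positive⁻¹ η {{ℚ.pos*pos⇒pos K⁻¹ {{ℚ.1/pos⇒pos K {{K>0}}}} ε {{ℚ.positive 0<ε}}}}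
      K*η≡ε : K ℚ.* η ≡ ε
      K*η≡ε = trans (sym (ℚ.*-assoc K K⁻¹ ε))
                (trans (cong (ℚ._* ε) (ℚ.*-inverseʳ K {{ℚ.pos⇒nonZero K {{K>0}}}}))
                  (ℚ.*-identityˡ ε))

    product-bound : ∀ a b K η → ℚ.Positive K → ℚ.∣ a ∣ ℚ.≤ K → ℚ.∣ b ∣ ℚ.< η →
                    ℚ.∣ a ℚ.* b ∣ ℚ.< K ℚ.* η
    product-bound a b K η K>0 a≤K b<η = begin-strict
      ℚ.∣ a ℚ.* b ∣           ≡⟨ ℚ.∣p*q∣≡∣p∣*∣q∣ a b ⟩
      ℚ.∣ a ∣ ℚ.* ℚ.∣ b ∣     ≤⟨ ℚ.*-monoʳ-≤-nonNeg ℚ.∣ b ∣ {{ℚ.∣-∣-nonNeg b}} a≤K ⟩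
      K ℚ.* ℚ.∣ b ∣           <⟨ ℚ.*-monoʳ-<-pos K {{K>0}} b<η ⟩
      K ℚ.* η                 ∎
      where open ℚ.≤-Reasoning

    product-difference : ∀ a b a′ b′ →
      a ℚ.* b ℚ.- a′ ℚ.* b′ ≡ a ℚ.* (b ℚ.- b′) ℚ.+ b′ ℚ.* (a ℚ.- a′)
    product-difference = solve 4 (λ a b a′ b′ →
      a :* b :- a′ :* b′ := a :* (b :- b′) :+ b′ :* (a :- a′)) refl
      where open +-*-Solver

    product-close : ∀ a b a′ b′ B C η →
      ℚ.Positive B → ℚ.∣ a ∣ ℚ.≤ B → ℚ.∣ b ℚ.- b′ ∣ ℚ.< η →
      ℚ.Positive C → ℚ.∣ b′ ∣ ℚ.≤ C → ℚ.∣ a ℚ.- a′ ∣ ℚ.< η →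
      ℚ.∣ a ℚ.* b ℚ.- a′ ℚ.* b′ ∣ ℚ.< (B ℚ.+ C) ℚ.* η
    product-close a b a′ b′ B C η B>0 a≤B b-b′<η C>0 b′≤C a-a′<η = begin-strict
      ℚ.∣ a ℚ.* b ℚ.- a′ ℚ.* b′ ∣
        ≡⟨ cong ℚ.∣_∣ (product-difference a b a′ b′) ⟩
      ℚ.∣ a ℚ.* (b ℚ.- b′) ℚ.+ b′ ℚ.* (a ℚ.- a′) ∣
        ≤⟨ ℚ.∣p+q∣≤∣p∣+∣q∣ (a ℚ.* (b ℚ.- b′)) (b′ ℚ.* (a ℚ.- a′)) ⟩
      ℚ.∣ a ℚ.* (b ℚ.- b′) ∣ ℚ.+ ℚ.∣ b′ ℚ.* (a ℚ.- a′) ∣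
        <⟨ ℚ.+-mono-< (product-bound a (b ℚ.- b′) B η B>0 a≤B b-b′<η)
                      (product-bound b′ (a ℚ.- a′) C η C>0 b′≤C a-a′<η) ⟩
      B ℚ.* η ℚ.+ C ℚ.* η
        ≡⟨ sym (ℚ.*-distribʳ-+ η B C) ⟩
      (B ℚ.+ C) ℚ.* η ∎
      where open ℚ.≤-Reasoning

    *-cauchy : ∀ {x y} → Cauchy x → Cauchy y → Cauchy (λ n → x n ℚ.* y n)
    *-cauchy {x} {y} cx cy ε 0<ε =
      let B , B>0 , M₁ , hB  = cauchy⇒bounded {x} cx
          C , C>0 , M₂ , hC  = cauchy⇒bounded {y} cy
          η , 0<η , [B+C]η≡ε = rescale (B ℚ.+ C) (ℚ.pos+pos⇒pos B {{B>0}} C {{C>0}}) ε 0<ε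
          N₁ , hx = cx η 0<η
          N₂ , hy = cy η 0<η
          M = M₁ ℕ.⊔ M₂
          N = N₁ ℕ.⊔ N₂
      in M ℕ.⊔ N , λ m n p q →
         subst (ℚ.∣ x m ℚ.* y m ℚ.- x n ℚ.* y n ∣ ℚ.<_) [B+C]η≡ε
           (product-close (x m) (y m) (x n) (y n) B C η
             B>0 (hB m (ℕ.m⊔n≤o⇒m≤o M₁ M₂ (ℕ.m⊔n≤o⇒m≤o M N p)))
             (hy m n (ℕ.m⊔n≤o⇒n≤o N₁ N₂ (ℕ.m⊔n≤o⇒n≤o M N p))
                     (ℕ.m⊔n≤o⇒n≤o N₁ N₂ (ℕ.m⊔n≤o⇒n≤o M N q)))
             C>0 (hC n (ℕ.m⊔n≤o⇒n≤o M₁ M₂ (ℕ.m⊔n≤o⇒m≤o M N q)))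
             (hx m n (ℕ.m⊔n≤o⇒m≤o N₁ N₂ (ℕ.m⊔n≤o⇒n≤o M N p))
                     (ℕ.m⊔n≤o⇒m≤o N₁ N₂ (ℕ.m⊔n≤o⇒n≤o M N q))))

open CauchyProperties

infix  4 _≃_ _≤_ _<_
infixl 6 _+_ _-_
infixl 7 _*_
infix  8 -_

_≃_ _≤_ _<_ : Rel ℝ 0ℓ
x ≃ y = ∀ ε → 0ℚ ℚ.< ε → Eventually λ n → ℚ.∣ seq x n ℚ.- seq y n ∣ ℚ.< ε
x ≤ y = ∀ ε → 0ℚ ℚ.< ε → Eventually λ n → seq x n ℚ.≤ seq y n ℚ.+ ε
x < y = ∃ λ ε → 0ℚ ℚ.< ε × Eventually λ n → seq x n ℚ.+ ε ℚ.≤ seq y n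

fromℚ : ℚ → ℝ
fromℚ p = mkℝ (λ _ → p) (const-cauchy p)

fromℕ : ℕ → ℝ
fromℕ n = fromℚ (ℤ.+ n ℚ./ 1)

0ℝ 1ℝ ½ℝ ⅓ℝ : ℝ
0ℝ = fromℚ 0ℚ
1ℝ = fromℚ 1ℚ
½ℝ = fromℚ ½
⅓ℝ = fromℚ (ℤ.+ 1 ℚ./ 3)

_+_ _*_ : ℝ → ℝ → ℝ
x + y = mkℝ (λ n → seq x n ℚ.+ seq y n) (+-cauchy {seq x} {seq y} (cauchy x) (cauchy y))
x * y = mkℝ (λ n → seq x n ℚ.* seq y n) (*-cauchy {seq x} {seq y} (cauchy x) (cauchy y))

-_ ∣_∣ℝ : ℝ → ℝ
- x     = mkℝ (λ n → ℚ.- seq x n) (neg-cauchy {seq x} (cauchy x))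
∣ x ∣ℝ = mkℝ (λ n → ℚ.∣ seq x n ∣) (abs-cauchy {seq x} (cauchy x))

_-_ : ℝ → ℝ → ℝ
x - y = x + (- y)

+-rawMonoid : RawMonoid 0ℓ 0ℓ
+-rawMonoid = record { Carrier = ℝ ; _≈_ = _≃_ ; _∙_ = _+_ ; ε = 0ℝ }

open RawMonoidDefinitions +-rawMonoid public using (sum)

record Distribution (n : ℕ) : Set where
  field
    mass     : Fin n → ℝ
    nonneg   : ∀ i → 0ℝ ≤ mass i
    sums-to1 : sum mass ≃ 1ℝ

open Distribution public

_≈_ : ∀ {n} → Rel (Distribution n) 0ℓ
μ ≈ μ′ = ∀ i → mass μ i ≃ mass μ′ i

massOn : ∀ {n} → Distribution n → Subset n → ℝ
massOn μ A = sum λ i → if lookup A i then mass μ i else 0ℝ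

d : ∀ {n} → Distribution n → Distribution n → ℝ
d μ μ′ = ½ℝ * sum λ i → ∣ mass μ i - mass μ′ i ∣ℝ

-- ℝ is a setoid, so a set of distributions is a predicate respecting ≈.
record Property (n : ℕ) : Set (lsuc 0ℓ) where
  field
    holds    : Pred (Distribution n) 0ℓ
    respects : holds Respects _≈_

open Property public

Far : ∀ {n} → ℝ → Property n → Pred (Distribution n) 0ℓ
Far ε P μ = ∀ μ′ → holds P μ′ → ε ≤ d μ μ′

Condition : ℕ → Set
Condition n = Σ (Subset n) Nonempty

-- Whether μ(A) vanishes is not decidable, so the law of the answers is
-- specified rather than computed; the quotients μ(j)/μ(A) and 1/|A| are
-- specified by cross-multiplication.  Classically the oracle of μ exists
-- and is unique up to ≃.
record Oracle {n : ℕ} (μ : Distribution n) : Set where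
  field
    answer      : Condition n → Distribution n
    outside     : ∀ ((A , ne) : Condition n) j → j ∉ A →
                  mass (answer (A , ne)) j ≃ 0ℝ
    conditioned : ∀ ((A , ne) : Condition n) j → j ∈ A → 0ℝ < massOn μ A →
                  mass (answer (A , ne)) j * massOn μ A ≃ mass μ j
    uniform     : ∀ ((A , ne) : Condition n) j → j ∈ A → massOn μ A ≃ 0ℝ →
                  mass (answer (A , ne)) j * fromℕ ∣ A ∣ ≃ 1ℝ

open Oracle public

-- The index q is an upper bound on the number of samples, since a verdict
-- may be reached early.
data Procedure (n : ℕ) : ℕ → Set where
  verdict : ∀ {q} (accept? : Bool) → Procedure n q
  query   : ∀ {q} (A : Condition n) (next : Fin n → Procedure n q) →
            Procedure n (suc q)

-- Samples are drawn independently of each other, so the probabilities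
-- along a branch multiply.
outcomeProb : ∀ {n q} {μ : Distribution n} → Oracle μ → Procedure n q → Bool → ℝ
outcomeProb O (verdict b)    b′ = if does (b Bool.≟ b′) then 1ℝ else 0ℝ
outcomeProb O (query A next) b′ =
  sum λ j → mass (answer O A) j * outcomeProb O (next j) b′

-- All coins are tossed in advance, with arbitrary real probabilities.
-- There are only finitely many procedures for given n and q, so a finite
-- space of coin outcomes is fully general.
record AdaptiveAlgorithm (n q : ℕ) : Set where
  field
    seeds : ℕ
    coins : Distribution seeds
    run   : Fin seeds → Procedure n q

record NonAdaptiveAlgorithm (n q : ℕ) : Set where
  field
    seeds  : ℕ
    coins  : Distribution seeds
    sets   : Fin seeds → Vec (Condition n) q
    decide : Fin seeds → Vec (Fin n) q → Bool

batch : ∀ {n q} → Vec (Condition n) q → (Vec (Fin n) q → Bool) → Procedure n q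
batch []       f = verdict (f [])
batch (A ∷ As) f = query A λ j → batch As λ js → f (j ∷ js)

toAdaptive : ∀ {n q} → NonAdaptiveAlgorithm n q → AdaptiveAlgorithm n q
toAdaptive T = record
  { seeds = seeds
  ; coins = coins
  ; run   = λ r → batch (sets r) (decide r)
  } where open NonAdaptiveAlgorithm T

Pr[_on_outputs_] : ∀ {n q} {μ : Distribution n} →
                   AdaptiveAlgorithm n q → Oracle μ → Bool → ℝ
Pr[ T on O outputs b ] = sum λ r → mass coins r * outcomeProb O (run r) b
  where open AdaptiveAlgorithm T

record IsAdaptiveTester {n q : ℕ} (P : Property n) (ε δ : ℝ)
                        (T : AdaptiveAlgorithm n q) : Set where
  field
    accepts : ∀ μ → holds P μ → (O : Oracle μ) →
              1ℝ - δ ≤ Pr[ T on O outputs true ]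
    rejects : ∀ μ → Far ε P μ → (O : Oracle μ) →
              1ℝ - δ ≤ Pr[ T on O outputs false ]

IsNonAdaptiveTester : ∀ {n q} → Property n → (ε δ : ℝ) → NonAdaptiveAlgorithm n q → Set
IsNonAdaptiveTester P ε δ T = IsAdaptiveTester P ε δ (toAdaptive T)

module Submission where

-- A point x of the Boolean cube of dimension m is encoded as a distribution on
-- m pairs of elements: the bit of a pair decides which of its two elements
-- has weight 1 and which has weight 1/2.  The total weight does not depend on
-- x, so normalising multiplies all weights by one constant, and the variation
-- distance of two encodings is proportional to the Hamming distance of the
-- two points.
--
-- All weights lie between 1/2 and 1.  Hence a conditional sample from A can be
-- produced by rejection sampling: draw j uniformly from A, read the one bit of
-- x that determines the weight of j, and keep j with probability equal to
-- that weight; each round succeeds with probability at least 1/2.  A procedure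
-- with q samples is therefore simulated by O(q) rounds, up to a small failure
-- probability (simulate≤probability, simulate-total, tail-small).  The
-- truncated simulation reads one bit per round, so its probability of
-- accepting is a polynomial in the bits of x whose degree is at most the number
-- of rounds.
--
-- Such a polynomial cannot distinguish two families of points all of whose
-- low-degree characters have the same averages (simulate-fooled).  A linear
-- code whose dual has minimum distance greater than k and any of its cosets
-- are such families for degree k: a nontrivial character of degree at most k
-- averages to zero on both (code-coset).  Counting gives a code of linear dual
-- distance (gilbertVarshamov) with few enough words that some translate of it
-- lies at linear Hamming distance from it (farPoint).
--
-- The property is "at distance at least 1/96 from every encoded point of the
-- coset".  Encoded codewords have it and encoded points of the coset are far
-- from it, so a tester accepts the former and rejects the latter with
-- probability 2/3 each.  The two averages add up to at least 4/3, whereas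
-- for every outcome of the coins they add up to at most 17/16 as long as
-- the simulation stays within degree k (success-bound,
-- tester-needs-samples).

open import Defs
open import Data.Nat.Base as ℕ using (ℕ)
open import Data.Product.Base using (Σ; ∃; _×_)

open import Algebra.Bundles using (CommutativeRing)
import Algebra.Properties.Semiring.Sum as SemiringSum
open import Data.Bool.Base using (Bool; true; false; not; _∧_; _xor_; if_then_else_)
import Data.Bool.Properties as Bool
open import Data.Fin.Base using (Fin; zero; suc)
open import Data.Fin.Subset as Subset using (Subset)
import Data.Integer.Base as ℤ
import Data.Integer.Properties as ℤ
open import Data.List.Base as List using (List; []; _∷_; length)
open import Data.List.Membership.Propositional using (_∈_; _∉_)
open import Data.List.Membership.Propositional.Properties
  using (∈-map⁺; ∈-++⁺ˡ; ∈-++⁺ʳ; ∈-cartesianProductWith⁺)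
import Data.List.Properties as List
open import Data.List.Relation.Unary.Any using (here; there)
open import Data.Nat.Base using (zero; suc; z≤n; s≤s)
import Data.Nat.DivMod as ℕ
import Data.Nat.Properties as ℕ
import Data.Nat.Solver as ℕ
open import Data.Product.Base using (_,_; proj₁; proj₂)
open import Data.Rational.Base as ℚ using (ℚ; 0ℚ; 1ℚ; ½)
import Data.Rational.Properties as ℚ
import Data.Rational.Solver as ℚ
import Data.Rational.Unnormalised.Base as ℚᵘ
import Data.Rational.Unnormalised.Properties as ℚᵘ
open import Data.Sum.Base using (inj₁; inj₂)
open import Data.Unit.Base using (⊤; tt)
open import Data.Vec.Base as Vec using (Vec; []; _∷_; lookup; replicate; zipWith)
import Data.Vec.Properties as Vec
open import Function.Base using (_∘_)
open import Relation.Binary.PropositionalEquality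
  using (_≡_; _≢_; refl; sym; trans; cong; cong₂; subst; module ≡-Reasoning)
open import Relation.Nullary.Decidable using (does; yes; no; toWitnessFalse)
open import Relation.Nullary.Negation using (¬_; contradiction)

open CauchyProperties using (0<½ε; ½ε+½ε≡ε; rescale)
open SemiringSum (CommutativeRing.semiring ℚ.+-*-commutativeRing)
  using (*-distribˡ-sum; *-distribʳ-sum; ∑-distrib-+) renaming (sum to ∑; sum-cong-≗ to ∑-cong)

-- Points of the Boolean cube

Cube : ℕ → Set
Cube = Vec Bool

infixl 6 _⊕_

_⊕_ : ∀ {m} → Cube m → Cube m → Cube m
_⊕_ = zipWith _xor_

origin : ∀ {m} → Cube m
origin {m} = replicate m false

weight : ∀ {m} → Cube m → ℕ
weight []          = 0
weight (false ∷ x) = weight x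
weight (true  ∷ x) = suc (weight x)

⊕-comm : ∀ {m} (x y : Cube m) → x ⊕ y ≡ y ⊕ x
⊕-comm = Vec.zipWith-comm Bool.xor-comm

⊕-assoc : ∀ {m} (x y z : Cube m) → (x ⊕ y) ⊕ z ≡ x ⊕ (y ⊕ z)
⊕-assoc = Vec.zipWith-assoc Bool.xor-assoc

⊕-self : ∀ {m} (x : Cube m) → x ⊕ x ≡ origin
⊕-self []      = refl
⊕-self (b ∷ x) = cong₂ _∷_ (Bool.xor-same b) (⊕-self x)

⊕-identityˡ : ∀ {m} (x : Cube m) → origin ⊕ x ≡ x
⊕-identityˡ = Vec.zipWith-identityˡ Bool.xor-identityˡ

⊕-cancelʳ : ∀ {m} (x y : Cube m) → x ⊕ (x ⊕ y) ≡ y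
⊕-cancelʳ x y = begin
  x ⊕ (x ⊕ y)  ≡⟨ ⊕-assoc x x y ⟨
  (x ⊕ x) ⊕ y  ≡⟨ cong (_⊕ y) (⊕-self x) ⟩
  origin ⊕ y   ≡⟨ ⊕-identityˡ y ⟩
  y            ∎
  where open ≡-Reasoning

⊕-origin⇒≡ : ∀ {m} (x y : Cube m) → x ⊕ y ≡ origin → x ≡ y
⊕-origin⇒≡ x y eq = begin
  x            ≡⟨ ⊕-cancelʳ y x ⟨
  y ⊕ (y ⊕ x)  ≡⟨ cong (y ⊕_) (trans (⊕-comm y x) eq) ⟩
  y ⊕ origin   ≡⟨ ⊕-comm y origin ⟩
  origin ⊕ y   ≡⟨ ⊕-identityˡ y ⟩
  y            ∎
  where open ≡-Reasoning

weight-origin : ∀ m → weight (origin {m}) ≡ 0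
weight-origin zero    = refl
weight-origin (suc m) = weight-origin m

weight-⊕ : ∀ {m} (s t : Cube m) → weight (s ⊕ t) ℕ.≤ weight s ℕ.+ weight t
weight-⊕ []          []          = z≤n
weight-⊕ (false ∷ s) (false ∷ t) = weight-⊕ s t
weight-⊕ (false ∷ s) (true  ∷ t) = subst (suc (weight (s ⊕ t)) ℕ.≤_) (sym (ℕ.+-suc _ _)) (s≤s (weight-⊕ s t))
weight-⊕ (true  ∷ s) (false ∷ t) = s≤s (weight-⊕ s t)
weight-⊕ (true  ∷ s) (true  ∷ t) = ℕ.≤-trans (weight-⊕ s t) (ℕ.+-mono-≤ (ℕ.n≤1+n _) (ℕ.n≤1+n _))

-- Parity and linear codes

parity : ∀ {m} → Cube m → Cube m → Bool
parity []      []      = false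
parity (a ∷ s) (b ∷ x) = (a ∧ b) xor parity s x

xor-interchange : ∀ a b c d → (a xor b) xor (c xor d) ≡ (a xor c) xor (b xor d)
xor-interchange false b c d = begin
  b xor (c xor d)  ≡⟨ Bool.xor-assoc b c d ⟨
  (b xor c) xor d  ≡⟨ cong (_xor d) (Bool.xor-comm b c) ⟩
  (c xor b) xor d  ≡⟨ Bool.xor-assoc c b d ⟩
  c xor (b xor d)  ∎
  where open ≡-Reasoning
xor-interchange true b c d = begin
  not b xor (c xor d)  ≡⟨ Bool.not-distribˡ-xor b (c xor d) ⟨
  not (b xor (c xor d)) ≡⟨ cong not (xor-interchange false b c d) ⟩
  not (c xor (b xor d)) ≡⟨ Bool.not-distribˡ-xor c (b xor d) ⟩
  not c xor (b xor d)  ∎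
  where open ≡-Reasoning

parity-comm : ∀ {m} (s x : Cube m) → parity s x ≡ parity x s
parity-comm []      []      = refl
parity-comm (a ∷ s) (b ∷ x) = cong₂ _xor_ (Bool.∧-comm a b) (parity-comm s x)

parity-⊕ʳ : ∀ {m} (s x y : Cube m) → parity s (x ⊕ y) ≡ parity s x xor parity s y
parity-⊕ʳ []      []      []      = refl
parity-⊕ʳ (a ∷ s) (b ∷ x) (c ∷ y) = begin
  (a ∧ (b xor c)) xor parity s (x ⊕ y)
    ≡⟨ cong₂ _xor_ (Bool.∧-distribˡ-xor a b c) (parity-⊕ʳ s x y) ⟩
  ((a ∧ b) xor (a ∧ c)) xor (parity s x xor parity s y)
    ≡⟨ xor-interchange (a ∧ b) (a ∧ c) (parity s x) (parity s y) ⟩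
  ((a ∧ b) xor parity s x) xor ((a ∧ c) xor parity s y) ∎
  where open ≡-Reasoning

parity-⊕ˡ : ∀ {m} (s t x : Cube m) → parity (s ⊕ t) x ≡ parity s x xor parity t x
parity-⊕ˡ s t x = begin
  parity (s ⊕ t) x         ≡⟨ parity-comm (s ⊕ t) x ⟩
  parity x (s ⊕ t)         ≡⟨ parity-⊕ʳ x s t ⟩
  parity x s xor parity x t ≡⟨ cong₂ _xor_ (parity-comm x s) (parity-comm x t) ⟩
  parity s x xor parity t x ∎
  where open ≡-Reasoning

-- The codeword with message y; the vectors in G are the columns of the generator
-- matrix.
encode : ∀ {r m} → Vec (Cube r) m → Cube r → Cube m
encode G y = Vec.map (parity y) G

combine : ∀ {r m} → Cube m → Vec (Cube r) m → Cube r
combine []          []      = origin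
combine (false ∷ s) (c ∷ G) = combine s G
combine (true  ∷ s) (c ∷ G) = c ⊕ combine s G

parity-origin : ∀ {m} (x : Cube m) → parity origin x ≡ false
parity-origin []      = refl
parity-origin (b ∷ x) = parity-origin x

-- Transposing the generator matrix turns a character of the codeword into a
-- character of the message.
parity-encode : ∀ {r m} (G : Vec (Cube r) m) s y →
                parity s (encode G y) ≡ parity (combine s G) y
parity-encode []      []          y = sym (parity-origin y)
parity-encode (c ∷ G) (false ∷ s) y = parity-encode G s y
parity-encode (c ∷ G) (true  ∷ s) y = begin
  parity y c xor parity s (encode G y)    ≡⟨ cong₂ _xor_ (parity-comm y c) (parity-encode G s y) ⟩
  parity c y xor parity (combine s G) y   ≡⟨ parity-⊕ˡ c (combine s G) y ⟨
  parity (c ⊕ combine s G) y              ∎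
  where open ≡-Reasoning

encode-⊕ : ∀ {r m} (G : Vec (Cube r) m) y z → encode G (y ⊕ z) ≡ encode G y ⊕ encode G z
encode-⊕ []      y z = refl
encode-⊕ (c ∷ G) y z = cong₂ _∷_ (parity-⊕ˡ y z c) (encode-⊕ G y z)

-- Balls, and points that avoid a short list

ball : ∀ m (k : ℕ) → List (Cube m)
ball zero    k       = [] ∷ []
ball (suc m) zero    = List.map (false ∷_) (ball m zero)
ball (suc m) (suc k) = List.map (false ∷_) (ball m (suc k)) List.++ List.map (true ∷_) (ball m k)

∈-ball : ∀ {m} k (x : Cube m) → weight x ℕ.≤ k → x ∈ ball m k
∈-ball k       []          w≤k       = here refl
∈-ball zero    (false ∷ x) w≤k       = ∈-map⁺ (false ∷_) (∈-ball zero x w≤k)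
∈-ball (suc k) (false ∷ x) w≤k       = ∈-++⁺ˡ (∈-map⁺ (false ∷_) (∈-ball (suc k) x w≤k))
∈-ball (suc k) (true  ∷ x) (s≤s w≤k) =
  ∈-++⁺ʳ (List.map (false ∷_) (ball _ (suc k))) (∈-map⁺ (true ∷_) (∈-ball k x w≤k))

volume : ℕ → ℕ → ℕ
volume m k = length (ball m k)

volume-suc : ∀ m k → volume (suc m) (suc k) ≡ volume m (suc k) ℕ.+ volume m k
volume-suc m k = trans (List.length-++ (List.map (false ∷_) (ball m (suc k))))
  (cong₂ ℕ._+_ (List.length-map _ (ball m (suc k))) (List.length-map _ (ball m k)))

volume-mono : ∀ m k → volume m k ℕ.≤ volume (suc m) k
volume-mono m zero    = ℕ.≤-reflexive (sym (List.length-map _ (ball m zero)))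
volume-mono m (suc k) = subst (volume m (suc k) ℕ.≤_) (sym (volume-suc m k)) (ℕ.m≤m+n _ _)

-- The bound on binomial sums by the binomial theorem: weighting the points of
-- weight i by 1/16 to the power i, all points of the cube together weigh 17/16
-- to the power m, and those in the ball weigh at least 1/16 to the power k each.
volume-bound : ∀ m k → volume m k ℕ.* 16 ℕ.^ m ℕ.≤ 17 ℕ.^ m ℕ.* 16 ℕ.^ k
volume-bound zero    k       = subst (1 ℕ.≤_) (sym (ℕ.*-identityˡ (16 ℕ.^ k))) (ℕ.m^n>0 16 k)
volume-bound (suc m) zero    = begin
  volume (suc m) 0 ℕ.* (16 ℕ.* 16 ℕ.^ m)
    ≡⟨ cong (ℕ._* (16 ℕ.* 16 ℕ.^ m)) (List.length-map _ (ball m zero)) ⟩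
  volume m 0 ℕ.* (16 ℕ.* 16 ℕ.^ m)
    ≡⟨ solve 2 (λ v p → v :* (con 16 :* p) := con 16 :* (v :* p)) refl (volume m 0) (16 ℕ.^ m) ⟩
  16 ℕ.* (volume m 0 ℕ.* 16 ℕ.^ m)
    ≤⟨ ℕ.*-mono-≤ (ℕ.n≤1+n 16) (volume-bound m zero) ⟩
  17 ℕ.* (17 ℕ.^ m ℕ.* 1)
    ≡⟨ ℕ.*-assoc 17 (17 ℕ.^ m) 1 ⟨
  17 ℕ.* 17 ℕ.^ m ℕ.* 1 ∎
  where open ℕ.≤-Reasoning
        open ℕ.+-*-Solver
volume-bound (suc m) (suc k) = begin
  volume (suc m) (suc k) ℕ.* (16 ℕ.* 16 ℕ.^ m)
    ≡⟨ cong (ℕ._* (16 ℕ.* 16 ℕ.^ m)) (volume-suc m k) ⟩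
  (volume m (suc k) ℕ.+ volume m k) ℕ.* (16 ℕ.* 16 ℕ.^ m)
    ≡⟨ solve 3 (λ v w p → (v :+ w) :* (con 16 :* p) := con 16 :* (v :* p) :+ con 16 :* (w :* p)) refl
         (volume m (suc k)) (volume m k) (16 ℕ.^ m) ⟩
  16 ℕ.* (volume m (suc k) ℕ.* 16 ℕ.^ m) ℕ.+ 16 ℕ.* (volume m k ℕ.* 16 ℕ.^ m)
    ≤⟨ ℕ.+-mono-≤ (ℕ.*-monoʳ-≤ 16 (volume-bound m (suc k))) (ℕ.*-monoʳ-≤ 16 (volume-bound m k)) ⟩
  16 ℕ.* (17 ℕ.^ m ℕ.* (16 ℕ.* 16 ℕ.^ k)) ℕ.+ 16 ℕ.* (17 ℕ.^ m ℕ.* 16 ℕ.^ k)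
    ≡⟨ solve 2 (λ a b → con 16 :* (a :* (con 16 :* b)) :+ con 16 :* (a :* b) := con 17 :* a :* (con 16 :* b)) refl
         (17 ℕ.^ m) (16 ℕ.^ k) ⟩
  17 ℕ.* 17 ℕ.^ m ℕ.* (16 ℕ.* 16 ℕ.^ k) ∎
  where open ℕ.≤-Reasoning
        open ℕ.+-*-Solver

allPoints : ∀ r → List (Cube r)
allPoints zero    = [] ∷ []
allPoints (suc r) = List.map (false ∷_) (allPoints r) List.++ List.map (true ∷_) (allPoints r)

∈-allPoints : ∀ {r} (y : Cube r) → y ∈ allPoints r
∈-allPoints []          = here refl
∈-allPoints (false ∷ y) = ∈-++⁺ˡ (∈-map⁺ (false ∷_) (∈-allPoints y))
∈-allPoints (true  ∷ y) =
  ∈-++⁺ʳ (List.map (false ∷_) (allPoints _)) (∈-map⁺ (true ∷_) (∈-allPoints y))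

length-allPoints : ∀ r → length (allPoints r) ≡ 2 ℕ.^ r
length-allPoints zero    = refl
length-allPoints (suc r) = begin
  length (allPoints (suc r))
    ≡⟨ List.length-++ (List.map (false ∷_) (allPoints r)) ⟩
  length (List.map (false ∷_) (allPoints r)) ℕ.+ length (List.map (true ∷_) (allPoints r))
    ≡⟨ cong₂ ℕ._+_ (List.length-map _ (allPoints r)) (List.length-map _ (allPoints r)) ⟩
  length (allPoints r) ℕ.+ length (allPoints r)
    ≡⟨ cong₂ ℕ._+_ (length-allPoints r) (trans (length-allPoints r) (sym (ℕ.+-identityʳ _))) ⟩
  2 ℕ.^ suc r ∎
  where open ≡-Reasoning

slice : ∀ {r} → Bool → List (Cube (suc r)) → List (Cube r)
slice b     []                = []
slice false ((false ∷ v) ∷ l) = v ∷ slice false l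
slice false ((true  ∷ v) ∷ l) = slice false l
slice true  ((false ∷ v) ∷ l) = slice true l
slice true  ((true  ∷ v) ∷ l) = v ∷ slice true l

length-slices : ∀ {r} (l : List (Cube (suc r))) →
                length (slice false l) ℕ.+ length (slice true l) ≡ length l
length-slices []                = refl
length-slices ((false ∷ v) ∷ l) = cong suc (length-slices l)
length-slices ((true  ∷ v) ∷ l) =
  trans (ℕ.+-suc (length (slice false l)) (length (slice true l))) (cong suc (length-slices l))

∈-slice : ∀ {r} b {v : Cube r} l → (b ∷ v) ∈ l → v ∈ slice b l
∈-slice false ((false ∷ _) ∷ l) (here refl) = here refl
∈-slice true  ((true  ∷ _) ∷ l) (here refl) = here refl
∈-slice false ((false ∷ _) ∷ l) (there p)   = there (∈-slice false l p)
∈-slice false ((true  ∷ _) ∷ l) (there p)   = ∈-slice false l p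
∈-slice true  ((false ∷ _) ∷ l) (there p)   = ∈-slice true l p
∈-slice true  ((true  ∷ _) ∷ l) (there p)   = there (∈-slice true l p)

-- If a list is too short to cover the cube, its part in one of the two halves of
-- the cube is too short to cover that half.
avoid : ∀ r (l : List (Cube r)) → length l ℕ.< 2 ℕ.^ r → ∃ λ v → v ∉ l
avoid zero    []      _        = [] , λ ()
avoid zero    (_ ∷ _) (s≤s ())
avoid (suc r) l       l<2^1+r with length (slice false l) ℕ.<? 2 ℕ.^ r
... | yes small = let v , v∉ = avoid r (slice false l) small in false ∷ v , v∉ ∘ ∈-slice false l
... | no  large = let v , v∉ = avoid r (slice true l) small in true ∷ v , v∉ ∘ ∈-slice true l
  where
  open ℕ.≤-Reasoning
  small : length (slice true l) ℕ.< 2 ℕ.^ r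
  small = ℕ.+-cancelˡ-< (2 ℕ.^ r) _ _ (begin-strict
    2 ℕ.^ r ℕ.+ length (slice true l)                 ≤⟨ ℕ.+-monoˡ-≤ _ (ℕ.≮⇒≥ large) ⟩
    length (slice false l) ℕ.+ length (slice true l)  ≡⟨ length-slices l ⟩
    length l                                          <⟨ l<2^1+r ⟩
    2 ℕ.^ r ℕ.+ (2 ℕ.^ r ℕ.+ 0)                       ≡⟨ cong (2 ℕ.^ r ℕ.+_) (ℕ.+-identityʳ _) ⟩
    2 ℕ.^ r ℕ.+ 2 ℕ.^ r                               ∎)

-- That any k columns are linearly independent says that the dual code has
-- minimum distance greater than k.
IndependentColumns : ∀ {r m} → ℕ → Vec (Cube r) m → Set
IndependentColumns k G = ∀ s → weight s ℕ.≤ k → combine s G ≡ origin → s ≡ origin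

-- The columns are chosen greedily.  A new column c would violate independence only
-- by being equal to the sum of at most k earlier columns, and a ball of radius k
-- counts those sums.
gilbertVarshamov : ∀ {r} m k → volume m k ℕ.< 2 ℕ.^ r →
                   ∃ λ (G : Vec (Cube r) m) → IndependentColumns k G
gilbertVarshamov zero    k V<2^r = [] , λ { [] _ _ → refl }
gilbertVarshamov {r} (suc m) k V<2^r = c ∷ G , independent
  where
  smaller : volume m k ℕ.< 2 ℕ.^ r
  smaller = ℕ.≤-<-trans (volume-mono m k) V<2^r
  IH : ∃ λ (G : Vec (Cube r) m) → IndependentColumns k G
  IH = gilbertVarshamov m k smaller
  G : Vec (Cube r) m
  G = proj₁ IH
  fresh : ∃ λ c → c ∉ List.map (λ s → combine s G) (ball m k)
  fresh = avoid r _ (subst (ℕ._< 2 ℕ.^ r) (sym (List.length-map _ (ball m k))) smaller)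
  c : Cube r
  c = proj₁ fresh
  independent : IndependentColumns k (c ∷ G)
  independent (false ∷ s) w≤k eq = cong (false ∷_) (proj₂ IH s w≤k eq)
  independent (true  ∷ s) w≤k eq = contradiction
    (subst (_∈ List.map (λ s → combine s G) (ball m k)) (sym (⊕-origin⇒≡ c (combine s G) eq))
       (∈-map⁺ (λ s → combine s G) (∈-ball k s (ℕ.<⇒≤ w≤k))))
    (proj₂ fresh)

length-cartesianProductWith : ∀ {A B C : Set} (f : A → B → C) xs ys →
  length (List.cartesianProductWith f xs ys) ≡ length xs ℕ.* length ys
length-cartesianProductWith f []       ys = refl
length-cartesianProductWith f (x ∷ xs) ys = trans (List.length-++ (List.map (f x) ys))
  (cong₂ ℕ._+_ (List.length-map (f x) ys) (length-cartesianProductWith f xs ys))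

-- The balls of radius t around all codewords together are too small to cover the
-- cube.
farPoint : ∀ {r m} (G : Vec (Cube r) m) t → 2 ℕ.^ r ℕ.* volume m t ℕ.< 2 ℕ.^ m →
           ∃ λ u → ∀ y → t ℕ.< weight (encode G y ⊕ u)
farPoint {r} {m} G t small = u , far
  where
  near : List (Cube m)
  near = List.cartesianProductWith (λ y e → encode G y ⊕ e) (allPoints r) (ball m t)
  found : ∃ λ u → u ∉ near
  found = avoid m near (subst (ℕ._< 2 ℕ.^ m)
    (sym (trans (length-cartesianProductWith _ (allPoints r) (ball m t))
                (cong (ℕ._* volume m t) (length-allPoints r)))) small)
  u : Cube m
  u = proj₁ found
  far : ∀ y → t ℕ.< weight (encode G y ⊕ u)
  far y = ℕ.≰⇒> λ w≤t → proj₂ found (subst (_∈ near) (⊕-cancelʳ (encode G y) u)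
    (∈-cartesianProductWith⁺ (λ y e → encode G y ⊕ e) (∈-allPoints y) (∈-ball t _ w≤t)))

-- The number 17 to the power 16 is just below 2 to the power 66, so each block
-- of 16 dimensions costs a factor 4 beyond 2 to the power 64, and each unit of
-- the radius costs a factor 16.
volume-linear : ∀ s → volume (s ℕ.* 16) s ℕ.≤ 2 ℕ.^ (s ℕ.* 6)
volume-linear s = ℕ.*-cancelʳ-≤ _ _ (16 ℕ.^ (s ℕ.* 16)) {{ℕ.m^n≢0 16 (s ℕ.* 16)}} (begin
  volume (s ℕ.* 16) s ℕ.* 16 ℕ.^ (s ℕ.* 16)   ≤⟨ volume-bound (s ℕ.* 16) s ⟩
  17 ℕ.^ (s ℕ.* 16) ℕ.* 16 ℕ.^ s              ≤⟨ ℕ.*-monoˡ-≤ (16 ℕ.^ s) base ⟩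
  2 ℕ.^ (s ℕ.* 66) ℕ.* 16 ℕ.^ s               ≡⟨ cong (2 ℕ.^ (s ℕ.* 66) ℕ.*_) (ℕ.^-*-assoc 2 4 s) ⟩
  2 ℕ.^ (s ℕ.* 66) ℕ.* 2 ℕ.^ (4 ℕ.* s)        ≡⟨ ℕ.^-distribˡ-+-* 2 (s ℕ.* 66) (4 ℕ.* s) ⟨
  2 ℕ.^ (s ℕ.* 66 ℕ.+ 4 ℕ.* s)                ≡⟨ cong (2 ℕ.^_) (solve 1 (λ s → s :* con 66 :+ con 4 :* s
                                                   := s :* con 6 :+ con 4 :* (s :* con 16)) refl s) ⟩
  2 ℕ.^ (s ℕ.* 6 ℕ.+ 4 ℕ.* (s ℕ.* 16))        ≡⟨ ℕ.^-distribˡ-+-* 2 (s ℕ.* 6) (4 ℕ.* (s ℕ.* 16)) ⟩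
  2 ℕ.^ (s ℕ.* 6) ℕ.* 2 ℕ.^ (4 ℕ.* (s ℕ.* 16)) ≡⟨ cong (2 ℕ.^ (s ℕ.* 6) ℕ.*_) (ℕ.^-*-assoc 2 4 (s ℕ.* 16)) ⟨
  2 ℕ.^ (s ℕ.* 6) ℕ.* 16 ℕ.^ (s ℕ.* 16)       ∎)
  where
  open ℕ.≤-Reasoning
  open ℕ.+-*-Solver
  base : 17 ℕ.^ (s ℕ.* 16) ℕ.≤ 2 ℕ.^ (s ℕ.* 66)
  base = begin
    17 ℕ.^ (s ℕ.* 16)      ≡⟨ cong (17 ℕ.^_) (ℕ.*-comm s 16) ⟩
    17 ℕ.^ (16 ℕ.* s)      ≡⟨ ℕ.^-*-assoc 17 16 s ⟨
    (17 ℕ.^ 16) ℕ.^ s      ≤⟨ ℕ.^-monoˡ-≤ s (ℕ.≤ᵇ⇒≤ (17 ℕ.^ 16) (2 ℕ.^ 66) tt) ⟩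
    (2 ℕ.^ 66) ℕ.^ s       ≡⟨ ℕ.^-*-assoc 2 66 s ⟩
    2 ℕ.^ (66 ℕ.* s)       ≡⟨ cong (2 ℕ.^_) (ℕ.*-comm 66 s) ⟩
    2 ℕ.^ (s ℕ.* 66)       ∎

-- Rational arithmetic

¼ ¾ : ℚ
¼ = ℤ.+ 1 ℚ./ 4
¾ = ℤ.+ 3 ℚ./ 4

-- Reduces an inequality to a ring identity and the nonnegativity of the gap.
≤-by-gap : ∀ {p q} r → 0ℚ ℚ.≤ r → q ≡ p ℚ.+ r → p ℚ.≤ q
≤-by-gap {p} r 0≤r refl = subst (ℚ._≤ p ℚ.+ r) (ℚ.+-identityʳ p) (ℚ.+-monoʳ-≤ p 0≤r)

0≤gap : ∀ {p q} → p ℚ.≤ q → 0ℚ ℚ.≤ q ℚ.- p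
0≤gap {p} {q} p≤q = subst (ℚ._≤ q ℚ.- p) (ℚ.+-inverseʳ p) (ℚ.+-monoˡ-≤ (ℚ.- p) p≤q)

0≤+ : ∀ {p q} → 0ℚ ℚ.≤ p → 0ℚ ℚ.≤ q → 0ℚ ℚ.≤ p ℚ.+ q
0≤+ = ℚ.+-mono-≤

0≤* : ∀ {p q} → 0ℚ ℚ.≤ p → 0ℚ ℚ.≤ q → 0ℚ ℚ.≤ p ℚ.* q
0≤* {p} {q} 0≤p 0≤q =
  subst (ℚ._≤ p ℚ.* q) (ℚ.*-zeroʳ p) (ℚ.*-monoˡ-≤-nonNeg p {{ℚ.nonNegative 0≤p}} 0≤q)

*-monoˡ-≤ : ∀ {r p q} → 0ℚ ℚ.≤ r → p ℚ.≤ q → r ℚ.* p ℚ.≤ r ℚ.* q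
*-monoˡ-≤ {r} 0≤r = ℚ.*-monoˡ-≤-nonNeg r {{ℚ.nonNegative 0≤r}}

0<* : ∀ {p q} → 0ℚ ℚ.< p → 0ℚ ℚ.< q → 0ℚ ℚ.< p ℚ.* q
0<* {p} {q} 0<p 0<q =
  ℚ.positive⁻¹ (p ℚ.* q) {{ℚ.pos*pos⇒pos p {{ℚ.positive 0<p}} q {{ℚ.positive 0<q}}}}

-- Total, with the value 0 at 0, so that formulas need no side conditions.
inverse : ℚ → ℚ
inverse p with p ℚ.≟ 0ℚ
... | yes _   = 0ℚ
... | no  p≢0 = (ℚ.1/ p) {{ℚ.≢-nonZero p≢0}}

inverse-* : ∀ {p} → 0ℚ ℚ.< p → inverse p ℚ.* p ≡ 1ℚ
inverse-* {p} 0<p with p ℚ.≟ 0ℚ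
... | yes p≡0 = contradiction (sym p≡0) (ℚ.<⇒≢ 0<p)
... | no  p≢0 = ℚ.*-inverseˡ p {{ℚ.≢-nonZero p≢0}}

0<inverse : ∀ {p} → 0ℚ ℚ.< p → 0ℚ ℚ.< inverse p
0<inverse {p} 0<p with p ℚ.≟ 0ℚ
... | yes p≡0 = contradiction (sym p≡0) (ℚ.<⇒≢ 0<p)
... | no  p≢0 = ℚ.positive⁻¹ _ {{ℚ.1/pos⇒pos p {{ℚ.positive 0<p}}}}

ι : ℕ → ℚ
ι n = ℤ.+ n ℚ./ 1

-- Proved on unnormalised fractions, where the identity is one of integers.
ι-suc : ∀ n → ι (suc n) ≡ 1ℚ ℚ.+ ι n
ι-suc n = ℚ.toℚᵘ-injective (begin
  ℚ.toℚᵘ (ι (suc n))                ≈⟨ ℚ.toℚᵘ-fromℚᵘ (ℚᵘ.mkℚᵘ (ℤ.+ suc n) 0) ⟩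
  ℚᵘ.mkℚᵘ (ℤ.+ suc n) 0             ≈⟨ ℚᵘ.*≡* (trans (ℤ.*-identityʳ (ℤ.+ suc n)) (sym (trans (ℤ.*-identityʳ _)
                                         (cong (λ i → ℤ.1ℤ ℤ.+ i) (ℤ.*-identityʳ (ℤ.+ n)))))) ⟩
  ℚᵘ.1ℚᵘ ℚᵘ.+ ℚᵘ.mkℚᵘ (ℤ.+ n) 0     ≈⟨ ℚᵘ.+-congʳ ℚᵘ.1ℚᵘ (ℚ.toℚᵘ-fromℚᵘ (ℚᵘ.mkℚᵘ (ℤ.+ n) 0)) ⟨
  ℚ.toℚᵘ 1ℚ ℚᵘ.+ ℚ.toℚᵘ (ι n)       ≈⟨ ℚ.toℚᵘ-homo-+ 1ℚ (ι n) ⟨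
  ℚ.toℚᵘ (1ℚ ℚ.+ ι n)               ∎)
  where open ℚᵘ.≃-Reasoning

0≤ι : ∀ n → 0ℚ ℚ.≤ ι n
0≤ι zero    = ℚ.≤-refl
0≤ι (suc n) = subst (0ℚ ℚ.≤_) (sym (ι-suc n)) (0≤+ (ℚ.nonNegative⁻¹ 1ℚ) (0≤ι n))

ι-+ : ∀ m n → ι (m ℕ.+ n) ≡ ι m ℚ.+ ι n
ι-+ zero    n = sym (ℚ.+-identityˡ (ι n))
ι-+ (suc m) n = begin
  ι (suc (m ℕ.+ n))       ≡⟨ ι-suc (m ℕ.+ n) ⟩
  1ℚ ℚ.+ ι (m ℕ.+ n)      ≡⟨ cong (1ℚ ℚ.+_) (ι-+ m n) ⟩
  1ℚ ℚ.+ (ι m ℚ.+ ι n)    ≡⟨ ℚ.+-assoc 1ℚ (ι m) (ι n) ⟨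
  1ℚ ℚ.+ ι m ℚ.+ ι n      ≡⟨ cong (ℚ._+ ι n) (ι-suc m) ⟨
  ι (suc m) ℚ.+ ι n       ∎
  where open ≡-Reasoning

ι-* : ∀ m n → ι (m ℕ.* n) ≡ ι m ℚ.* ι n
ι-* zero    n = sym (ℚ.*-zeroˡ (ι n))
ι-* (suc m) n = begin
  ι (n ℕ.+ m ℕ.* n)           ≡⟨ ι-+ n (m ℕ.* n) ⟩
  ι n ℚ.+ ι (m ℕ.* n)         ≡⟨ cong₂ ℚ._+_ (sym (ℚ.*-identityˡ (ι n))) (ι-* m n) ⟩
  1ℚ ℚ.* ι n ℚ.+ ι m ℚ.* ι n  ≡⟨ ℚ.*-distribʳ-+ (ι n) 1ℚ (ι m) ⟨
  (1ℚ ℚ.+ ι m) ℚ.* ι n        ≡⟨ cong (ℚ._* ι n) (ι-suc m) ⟨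
  ι (suc m) ℚ.* ι n           ∎
  where open ≡-Reasoning

ι-mono : ∀ {m n} → m ℕ.≤ n → ι m ℚ.≤ ι n
ι-mono {m} {n} m≤n = ≤-by-gap (ι (n ℕ.∸ m)) (0≤ι (n ℕ.∸ m))
  (trans (cong ι (sym (ℕ.m+[n∸m]≡n m≤n))) (ι-+ m (n ℕ.∸ m)))

-- Finite sums

∑-mono : ∀ {n} {f g : Fin n → ℚ} → (∀ i → f i ℚ.≤ g i) → ∑ f ℚ.≤ ∑ g
∑-mono {zero}  f≤g = ℚ.≤-refl
∑-mono {suc n} f≤g = ℚ.+-mono-≤ (f≤g zero) (∑-mono (f≤g ∘ suc))

∑-nonneg : ∀ {n} {f : Fin n → ℚ} → (∀ i → 0ℚ ℚ.≤ f i) → 0ℚ ℚ.≤ ∑ f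
∑-nonneg {zero}  0≤f = ℚ.≤-refl
∑-nonneg {suc n} 0≤f = 0≤+ (0≤f zero) (∑-nonneg (0≤f ∘ suc))

∑-positive : ∀ {n} {f : Fin n → ℚ} → (∀ i → 0ℚ ℚ.≤ f i) → ∀ i → 0ℚ ℚ.< f i → 0ℚ ℚ.< ∑ f
∑-positive 0≤f zero    0<fi = ℚ.+-mono-<-≤ 0<fi (∑-nonneg (0≤f ∘ suc))
∑-positive 0≤f (suc i) 0<fi = ℚ.+-mono-≤-< (0≤f zero) (∑-positive (0≤f ∘ suc) i 0<fi)

normalised : ∀ {n} → (Fin n → ℚ) → Fin n → ℚ
normalised g i = g i ℚ.* inverse (∑ g)

∑-normalised : ∀ {n} (g : Fin n → ℚ) → 0ℚ ℚ.< ∑ g → ∑ (normalised g) ≡ 1ℚ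
∑-normalised g 0<∑ = begin
  ∑ (λ i → g i ℚ.* inverse (∑ g))  ≡⟨ *-distribʳ-sum (inverse (∑ g)) g ⟨
  ∑ g ℚ.* inverse (∑ g)            ≡⟨ ℚ.*-comm (∑ g) (inverse (∑ g)) ⟩
  inverse (∑ g) ℚ.* ∑ g            ≡⟨ inverse-* 0<∑ ⟩
  1ℚ                               ∎
  where open ≡-Reasoning

normalised-nonneg : ∀ {n} (g : Fin n → ℚ) → (∀ i → 0ℚ ℚ.≤ g i) → 0ℚ ℚ.< ∑ g →
                   ∀ i → 0ℚ ℚ.≤ normalised g i
normalised-nonneg g 0≤g 0<∑ i = 0≤* (0≤g i) (ℚ.<⇒≤ (0<inverse 0<∑))

-- Averages over a cube

avg : ∀ {r} → (Cube r → ℚ) → ℚ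
avg {zero}  f = f []
avg {suc r} f = ½ ℚ.* (avg (f ∘ (false ∷_)) ℚ.+ avg (f ∘ (true ∷_)))

avg-cong : ∀ {r} {f g : Cube r → ℚ} → (∀ y → f y ≡ g y) → avg f ≡ avg g
avg-cong {zero}  f≡g = f≡g []
avg-cong {suc r} f≡g =
  cong (½ ℚ.*_) (cong₂ ℚ._+_ (avg-cong (f≡g ∘ (false ∷_))) (avg-cong (f≡g ∘ (true ∷_))))

avg-mono : ∀ {r} {f g : Cube r → ℚ} → (∀ y → f y ℚ.≤ g y) → avg f ℚ.≤ avg g
avg-mono {zero}  f≤g = f≤g []
avg-mono {suc r} f≤g = *-monoˡ-≤ (ℚ.nonNegative⁻¹ ½)
  (ℚ.+-mono-≤ (avg-mono (f≤g ∘ (false ∷_))) (avg-mono (f≤g ∘ (true ∷_))))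

avg-const : ∀ {r} p → avg {r} (λ _ → p) ≡ p
avg-const {zero}  p = refl
avg-const {suc r} p = trans (cong (λ a → ½ ℚ.* (a ℚ.+ a)) (avg-const {r} p))
  (trans (ℚ.*-distribˡ-+ ½ p p) (trans (sym (ℚ.*-distribʳ-+ p ½ ½)) (ℚ.*-identityˡ p)))

avg-+ : ∀ {r} (f g : Cube r → ℚ) → avg (λ y → f y ℚ.+ g y) ≡ avg f ℚ.+ avg g
avg-+ {zero}  f g = refl
avg-+ {suc r} f g = trans
  (cong (½ ℚ.*_) (cong₂ ℚ._+_ (avg-+ (f ∘ (false ∷_)) (g ∘ (false ∷_)))
                              (avg-+ (f ∘ (true ∷_)) (g ∘ (true ∷_)))))
  (solve 5 (λ h a b c d → h :* ((a :+ b) :+ (c :+ d)) := h :* (a :+ c) :+ h :* (b :+ d)) refl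
     ½ (avg (f ∘ (false ∷_))) (avg (g ∘ (false ∷_))) (avg (f ∘ (true ∷_))) (avg (g ∘ (true ∷_))))
  where open ℚ.+-*-Solver

avg-* : ∀ {r} c (f : Cube r → ℚ) → avg (λ y → c ℚ.* f y) ≡ c ℚ.* avg f
avg-* {zero}  c f = refl
avg-* {suc r} c f = trans
  (cong (½ ℚ.*_) (cong₂ ℚ._+_ (avg-* c (f ∘ (false ∷_))) (avg-* c (f ∘ (true ∷_)))))
  (solve 4 (λ h c a b → h :* (c :* a :+ c :* b) := c :* (h :* (a :+ b))) refl
     ½ c (avg (f ∘ (false ∷_))) (avg (f ∘ (true ∷_))))
  where open ℚ.+-*-Solver

avg-∑ : ∀ {r n} (f : Fin n → Cube r → ℚ) → avg (λ y → ∑ (λ i → f i y)) ≡ ∑ (λ i → avg (f i))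
avg-∑ {r} {zero}  f = avg-const {r} 0ℚ
avg-∑ {r} {suc n} f = trans (avg-+ (f zero) (λ y → ∑ (λ i → f (suc i) y)))
  (cong (avg (f zero) ℚ.+_) (avg-∑ (f ∘ suc)))

-- Characters and indistinguishable families

sign : Bool → ℚ
sign false = 1ℚ
sign true  = ℚ.- 1ℚ

sign-xor : ∀ a b → sign (a xor b) ≡ sign a ℚ.* sign b
sign-xor false b     = sym (ℚ.*-identityˡ (sign b))
sign-xor true  false = refl
sign-xor true  true  = refl

-- The character s, a monomial of degree weight s in the signs of the bits.
χ : ∀ {m} → Cube m → Cube m → ℚ
χ s x = sign (parity s x)

χ-⊕ˡ : ∀ {m} (s t x : Cube m) → χ (s ⊕ t) x ≡ χ s x ℚ.* χ t x
χ-⊕ˡ s t x = trans (cong sign (parity-⊕ˡ s t x)) (sign-xor (parity s x) (parity t x))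

χ-⊕ʳ : ∀ {m} (s x y : Cube m) → χ s (x ⊕ y) ≡ χ s x ℚ.* χ s y
χ-⊕ʳ s x y = trans (cong sign (parity-⊕ʳ s x y)) (sign-xor (parity s x) (parity s y))

-- Flipping a bit selected by v changes the sign of the character.
avg-χ : ∀ {r} (v : Cube r) → v ≢ origin → avg (χ v) ≡ 0ℚ
avg-χ []          v≢0 = contradiction refl v≢0
avg-χ (false ∷ v) v≢0 = cong (λ a → ½ ℚ.* (a ℚ.+ a)) (avg-χ v (v≢0 ∘ cong (false ∷_)))
avg-χ (true  ∷ v) v≢0 = begin
  ½ ℚ.* (avg (χ v) ℚ.+ avg (λ y → χ (true ∷ v) (true ∷ y)))
    ≡⟨ cong (λ a → ½ ℚ.* (avg (χ v) ℚ.+ a)) (trans (avg-cong (λ y → sign-xor true (parity v y)))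
                                                  (avg-* (ℚ.- 1ℚ) (χ v))) ⟩
  ½ ℚ.* (avg (χ v) ℚ.+ (ℚ.- 1ℚ) ℚ.* avg (χ v))
    ≡⟨ solve 2 (λ h a → h :* (a :+ (:- con 1ℚ) :* a) := con 0ℚ) refl ½ (avg (χ v)) ⟩
  0ℚ ∎
  where open ≡-Reasoning
        open ℚ.+-*-Solver

-- All monomials of degree at most k have equal averages over the two families, that
-- is, the marginals of the two families on any k coordinates coincide.
Indistinguishable : ∀ {r m} → ℕ → (c₀ c₁ : Cube r → Cube m) → Set
Indistinguishable k c₀ c₁ = ∀ s → weight s ℕ.≤ k → avg (χ s ∘ c₀) ≡ avg (χ s ∘ c₁)

-- A character s other than the trivial one pulls back to a character of the message
-- that is nontrivial because the columns selected by s are independent, so it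
-- averages to 0; translating by u multiplies it by a constant.
code-coset : ∀ {r m k} (G : Vec (Cube r) m) → IndependentColumns k G → ∀ u →
             Indistinguishable k (encode G) (λ y → encode G y ⊕ u)
code-coset G independent u s w≤k with Vec.≡-dec Bool._≟_ s origin
... | yes refl = avg-cong λ y → cong sign
  (trans (parity-origin (encode G y)) (sym (parity-origin (encode G y ⊕ u))))
... | no s≢0 = begin
  avg (λ y → χ s (encode G y))                 ≡⟨ zero-mean ⟩
  0ℚ                                           ≡⟨ ℚ.*-zeroʳ (χ s u) ⟨
  χ s u ℚ.* 0ℚ                                 ≡⟨ cong (χ s u ℚ.*_) zero-mean ⟨
  χ s u ℚ.* avg (λ y → χ s (encode G y))       ≡⟨ avg-* (χ s u) (λ y → χ s (encode G y)) ⟨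
  avg (λ y → χ s u ℚ.* χ s (encode G y))       ≡⟨ avg-cong (λ y → trans (ℚ.*-comm (χ s u) (χ s (encode G y)))
                                                    (sym (χ-⊕ʳ s (encode G y) u))) ⟩
  avg (λ y → χ s (encode G y ⊕ u))             ∎
  where
  open ≡-Reasoning
  zero-mean : avg (λ y → χ s (encode G y)) ≡ 0ℚ
  zero-mean = trans (avg-cong (λ y → cong sign (parity-encode G s y)))
                    (avg-χ (combine s G) (s≢0 ∘ independent s w≤k))

-- Weights that encode a point of the cube

bitWeight : Bool → ℚ
bitWeight false = 1ℚ
bitWeight true  = ½

-- The first m pairs of elements carry the m bits; the last L elements only pad the
-- domain to the required size, and their weight is the mean of 1 and 1/2.
weights : ∀ {m L} → Cube m → Fin (m ℕ.* 2 ℕ.+ L) → ℚ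
weights []      _             = ¾
weights (b ∷ x) zero          = bitWeight b
weights (b ∷ x) (suc zero)    = bitWeight (not b)
weights (b ∷ x) (suc (suc j)) = weights x j

-- Each weight depends on at most one bit, hence has degree at most 1.
weights-affine : ∀ {m L} (j : Fin (m ℕ.* 2 ℕ.+ L)) → ∃ λ p → ∃ λ t → weight t ℕ.≤ 1 ×
                 (∀ (x : Cube m) → weights {L = L} x j ≡ ¾ ℚ.+ p ℚ.* χ t x)
weights-affine {zero}  j = 0ℚ , [] , z≤n , λ { [] → refl }
weights-affine {suc m} zero = ¼ , true ∷ origin , s≤s (ℕ.≤-reflexive (weight-origin m)) , λ
  { (false ∷ x) → cong (λ b → ¾ ℚ.+ ¼ ℚ.* sign b) (sym (parity-origin x))
  ; (true  ∷ x) → cong (λ b → ¾ ℚ.+ ¼ ℚ.* sign (not b)) (sym (parity-origin x)) }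
weights-affine {suc m} (suc zero) = ℚ.- ¼ , true ∷ origin , s≤s (ℕ.≤-reflexive (weight-origin m)) , λ
  { (false ∷ x) → cong (λ b → ¾ ℚ.+ (ℚ.- ¼) ℚ.* sign b) (sym (parity-origin x))
  ; (true  ∷ x) → cong (λ b → ¾ ℚ.+ (ℚ.- ¼) ℚ.* sign (not b)) (sym (parity-origin x)) }
weights-affine {suc m} (suc (suc j)) =
  let p , t , w≤1 , affine = weights-affine {m} j in
  p , false ∷ t , w≤1 , λ { (b ∷ x) → affine x }

weights-bounds : ∀ {m L} (x : Cube m) j → ½ ℚ.≤ weights {L = L} x j × weights {L = L} x j ℚ.≤ 1ℚ
weights-bounds []          j             = ℚ.≤ᵇ⇒≤ _ , ℚ.≤ᵇ⇒≤ _
weights-bounds (false ∷ x) zero          = ℚ.≤ᵇ⇒≤ _ , ℚ.≤ᵇ⇒≤ _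
weights-bounds (true  ∷ x) zero          = ℚ.≤ᵇ⇒≤ _ , ℚ.≤ᵇ⇒≤ _
weights-bounds (false ∷ x) (suc zero)    = ℚ.≤ᵇ⇒≤ _ , ℚ.≤ᵇ⇒≤ _
weights-bounds (true  ∷ x) (suc zero)    = ℚ.≤ᵇ⇒≤ _ , ℚ.≤ᵇ⇒≤ _
weights-bounds (b     ∷ x) (suc (suc j)) = weights-bounds x j

-- Each pair weighs 3/2 whatever its bit is.
∑-weights : ∀ {m L} (x : Cube m) → ∑ (weights {L = L} x) ≡ ¾ ℚ.* ι (m ℕ.* 2 ℕ.+ L)
∑-weights {L = L} []      = flat L
  where
  flat : ∀ L → ∑ {L} (λ _ → ¾) ≡ ¾ ℚ.* ι L
  flat zero    = refl
  flat (suc L) = begin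
    ¾ ℚ.+ ∑ {L} (λ _ → ¾)     ≡⟨ cong₂ ℚ._+_ (sym (ℚ.*-identityʳ ¾)) (flat L) ⟩
    ¾ ℚ.* 1ℚ ℚ.+ ¾ ℚ.* ι L    ≡⟨ ℚ.*-distribˡ-+ ¾ 1ℚ (ι L) ⟨
    ¾ ℚ.* (1ℚ ℚ.+ ι L)        ≡⟨ cong (¾ ℚ.*_) (ι-suc L) ⟨
    ¾ ℚ.* ι (suc L)           ∎
    where open ≡-Reasoning
∑-weights {suc m} {L} (b ∷ x) = begin
  bitWeight b ℚ.+ (bitWeight (not b) ℚ.+ ∑ (weights x))
    ≡⟨ ℚ.+-assoc (bitWeight b) (bitWeight (not b)) (∑ (weights x)) ⟨
  (bitWeight b ℚ.+ bitWeight (not b)) ℚ.+ ∑ (weights x)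
    ≡⟨ cong₂ ℚ._+_ (pair b) (∑-weights x) ⟩
  ¾ ℚ.* ι 2 ℚ.+ ¾ ℚ.* ι (m ℕ.* 2 ℕ.+ L)
    ≡⟨ ℚ.*-distribˡ-+ ¾ (ι 2) (ι (m ℕ.* 2 ℕ.+ L)) ⟨
  ¾ ℚ.* (ι 2 ℚ.+ ι (m ℕ.* 2 ℕ.+ L))
    ≡⟨ cong (¾ ℚ.*_) (ι-+ 2 (m ℕ.* 2 ℕ.+ L)) ⟨
  ¾ ℚ.* ι (2 ℕ.+ (m ℕ.* 2 ℕ.+ L)) ∎
  where
  open ≡-Reasoning
  pair : ∀ b → bitWeight b ℚ.+ bitWeight (not b) ≡ ¾ ℚ.* ι 2
  pair false = refl
  pair true  = refl

-- A pair with different bits contributes 1/2 for each of its two elements.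
weights-distance : ∀ {m L} (x y : Cube m) →
  ∑ (λ j → ℚ.∣ weights {L = L} x j ℚ.- weights y j ∣) ≡ ι (weight (x ⊕ y))
weights-distance {L = L} []      []      = flat L
  where
  flat : ∀ L → ∑ {L} (λ _ → ℚ.∣ ¾ ℚ.- ¾ ∣) ≡ 0ℚ
  flat zero    = refl
  flat (suc L) = cong (0ℚ ℚ.+_) (flat L)
weights-distance {suc m} {L} (b ∷ x) (c ∷ y) = pair b c
  where
  rest : ℚ
  rest = ∑ (λ j → ℚ.∣ weights {m} {L} x j ℚ.- weights y j ∣)
  agree : 0ℚ ℚ.+ (0ℚ ℚ.+ rest) ≡ ι (weight (x ⊕ y))
  agree = trans (ℚ.+-identityˡ _) (trans (ℚ.+-identityˡ rest) (weights-distance x y))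
  differ : ½ ℚ.+ (½ ℚ.+ rest) ≡ ι (suc (weight (x ⊕ y)))
  differ = trans (sym (ℚ.+-assoc ½ ½ rest))
    (trans (cong (1ℚ ℚ.+_) (weights-distance x y)) (sym (ι-suc (weight (x ⊕ y)))))
  pair : ∀ b c → ∑ (λ j → ℚ.∣ weights {L = L} (b ∷ x) j ℚ.- weights (c ∷ y) j ∣)
               ≡ ι (weight ((b ∷ x) ⊕ (c ∷ y)))
  pair false false = agree
  pair false true  = differ
  pair true  false = differ
  pair true  true  = agree

-- Conditional sampling and its simulation

-- The upper bound makes w j an acceptance probability, and the lower bound
-- lets every round of rejection sampling succeed with probability at least 1/2.
Moderate : ∀ {n} → (Fin n → ℚ) → Set
Moderate w = ∀ j → ½ ℚ.≤ w j × w j ℚ.≤ 1ℚ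

moderate⇒positive : ∀ {n} {w : Fin n → ℚ} → Moderate w → ∀ j → 0ℚ ℚ.< w j
moderate⇒positive wm j = ℚ.<-≤-trans (ℚ.positive⁻¹ ½) (proj₁ (wm j))

indicator : ∀ {n} → Subset n → Fin n → ℚ
indicator A j = if lookup A j then 1ℚ else 0ℚ

uniformOn : ∀ {n} → Condition n → Fin n → ℚ
uniformOn (A , _) = normalised (indicator A)

-- The law of a conditional sample: it does not depend on the scale of w.
conditionalOn : ∀ {n} → (Fin n → ℚ) → Condition n → Fin n → ℚ
conditionalOn w (A , _) = normalised (λ j → indicator A j ℚ.* w j)

indicator-nonneg : ∀ {n} (A : Subset n) j → 0ℚ ℚ.≤ indicator A j
indicator-nonneg A j with lookup A j
... | true  = ℚ.nonNegative⁻¹ 1ℚ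
... | false = ℚ.≤-refl

∑-on-condition : ∀ {n} {w : Fin n → ℚ} → (∀ j → 0ℚ ℚ.< w j) → ((A , _) : Condition n) →
                 0ℚ ℚ.< ∑ (λ j → indicator A j ℚ.* w j)
∑-on-condition {w = w} 0<w (A , i , i∈A) =
  ∑-positive (λ j → 0≤* (indicator-nonneg A j) (ℚ.<⇒≤ (0<w j))) i
    (subst (λ b → 0ℚ ℚ.< (if b then 1ℚ else 0ℚ) ℚ.* w i) (sym (Vec.[]=⇒lookup i∈A))
      (subst (0ℚ ℚ.<_) (sym (ℚ.*-identityˡ (w i))) (0<w i)))

∑-indicator : ∀ {n} ((A , _) : Condition n) → 0ℚ ℚ.< ∑ (indicator A)
∑-indicator A′@(A , _) = subst (0ℚ ℚ.<_) (∑-cong (λ j → ℚ.*-identityʳ (indicator A j)))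
  (∑-on-condition (λ _ → ℚ.positive⁻¹ 1ℚ) A′)

∑-uniform : ∀ {n} (A : Condition n) → ∑ (uniformOn A) ≡ 1ℚ
∑-uniform A′@(A , _) = ∑-normalised (indicator A) (∑-indicator A′)

∑-conditional : ∀ {n} (w : Fin n → ℚ) → (∀ j → 0ℚ ℚ.< w j) → ∀ A → ∑ (conditionalOn w A) ≡ 1ℚ
∑-conditional w 0<w A′@(A , _) = ∑-normalised (λ j → indicator A j ℚ.* w j) (∑-on-condition 0<w A′)

truth : Bool → Bool → ℚ
truth b b′ = if does (b Bool.≟ b′) then 1ℚ else 0ℚ

-- The probability of the verdict when the distribution is proportional to w.
probability : ∀ {n q} → (Fin n → ℚ) → Procedure n q → Bool → ℚ
probability w (verdict b)    b′ = truth b b′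
probability w (query A next) b′ = ∑ λ j → conditionalOn w A j ℚ.* probability w (next j) b′

-- The probability that the simulation by rejection sampling reaches the verdict
-- within fewer than K further rounds; a rejected sample repeats the same query.
simulate : ∀ {n q} → (Fin n → ℚ) → ℕ → Procedure n q → Bool → ℚ
simulate w zero    p              b′ = 0ℚ
simulate w (suc K) (verdict b)    b′ = truth b b′
simulate w (suc K) (query A next) b′ = ∑ λ j → uniformOn A j ℚ.*
  (w j ℚ.* simulate w K (next j) b′ ℚ.+ (1ℚ ℚ.- w j) ℚ.* simulate w K (query A next) b′)

truth-nonneg : ∀ b b′ → 0ℚ ℚ.≤ truth b b′
truth-nonneg true  true  = ℚ.nonNegative⁻¹ 1ℚ
truth-nonneg true  false = ℚ.≤-refl
truth-nonneg false true  = ℚ.≤-refl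
truth-nonneg false false = ℚ.nonNegative⁻¹ 1ℚ

truth-total : ∀ b → truth b true ℚ.+ truth b false ≡ 1ℚ
truth-total true  = refl
truth-total false = refl

conditional-nonneg : ∀ {n} {w : Fin n → ℚ} → Moderate w → ∀ A j → 0ℚ ℚ.≤ conditionalOn w A j
conditional-nonneg {w = w} wm A′@(A , _) = normalised-nonneg (λ j → indicator A j ℚ.* w j)
  (λ j → 0≤* (indicator-nonneg A j) (ℚ.<⇒≤ (moderate⇒positive wm j)))
  (∑-on-condition (moderate⇒positive wm) A′)

probability-nonneg : ∀ {n q} {w : Fin n → ℚ} → Moderate w → (p : Procedure n q) → ∀ b →
                     0ℚ ℚ.≤ probability w p b
probability-nonneg wm (verdict b)    b′ = truth-nonneg b b′
probability-nonneg wm (query A next) b′ =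
  ∑-nonneg λ j → 0≤* (conditional-nonneg wm A j) (probability-nonneg wm (next j) b′)

∑-convex : ∀ {n} (g : Fin n → ℚ) p → ∑ g ≡ 1ℚ → ∑ (λ j → g j ℚ.* p) ≡ p
∑-convex g p ∑g≡1 = trans (sym (*-distribʳ-sum p g)) (trans (cong (ℚ._* p) ∑g≡1) (ℚ.*-identityˡ p))

probability-total : ∀ {n q} {w : Fin n → ℚ} → Moderate w → (p : Procedure n q) →
                    probability w p true ℚ.+ probability w p false ≡ 1ℚ
probability-total         wm (verdict b)    = truth-total b
probability-total {w = w} wm (query A next) = begin
  ∑ (λ j → c j ℚ.* P j true) ℚ.+ ∑ (λ j → c j ℚ.* P j false)
    ≡⟨ ∑-distrib-+ (λ j → c j ℚ.* P j true) (λ j → c j ℚ.* P j false) ⟨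
  ∑ (λ j → c j ℚ.* P j true ℚ.+ c j ℚ.* P j false)
    ≡⟨ ∑-cong (λ j → trans (sym (ℚ.*-distribˡ-+ (c j) (P j true) (P j false)))
                           (cong (c j ℚ.*_) (probability-total wm (next j)))) ⟩
  ∑ (λ j → c j ℚ.* 1ℚ)
    ≡⟨ ∑-convex c 1ℚ (∑-conditional w (moderate⇒positive wm) A) ⟩
  1ℚ ∎
  where
  open ≡-Reasoning
  c = conditionalOn w A
  P = λ j → probability w (next j)

-- One round of rejection sampling followed by a fresh start on rejection does not
-- change the probability of the outcome.
rejection-sampling : ∀ {n} (w : Fin n → ℚ) → Moderate w → ∀ A (P : Fin n → ℚ) →
  let R = ∑ (λ j → conditionalOn w A j ℚ.* P j) in
  ∑ (λ j → uniformOn A j ℚ.* (w j ℚ.* P j ℚ.+ (1ℚ ℚ.- w j) ℚ.* R)) ≡ R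
rejection-sampling w wm A′@(A , _) P = begin
  ∑ (λ j → u j ℚ.* (w j ℚ.* P j ℚ.+ (1ℚ ℚ.- w j) ℚ.* R))
    ≡⟨ ∑-cong (λ j → solve 5 (λ c i w P R →
         c :* i :* (w :* P :+ (con 1ℚ :- w) :* R) :=
         i :* (c :* w :* P) :+ (c :* i :* R :+ (:- (i :* R)) :* (c :* w))) refl (c j) i (w j) (P j) R) ⟩
  ∑ (λ j → i ℚ.* (c j ℚ.* w j ℚ.* P j) ℚ.+ (u j ℚ.* R ℚ.+ (ℚ.- (i ℚ.* R)) ℚ.* (c j ℚ.* w j)))
    ≡⟨ ∑-distrib-+ (λ j → i ℚ.* (c j ℚ.* w j ℚ.* P j)) (λ j → u j ℚ.* R ℚ.+ (ℚ.- (i ℚ.* R)) ℚ.* (c j ℚ.* w j)) ⟩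
  ∑ (λ j → i ℚ.* (c j ℚ.* w j ℚ.* P j)) ℚ.+ ∑ (λ j → u j ℚ.* R ℚ.+ (ℚ.- (i ℚ.* R)) ℚ.* (c j ℚ.* w j))
    ≡⟨ cong₂ ℚ._+_ (sym (*-distribˡ-sum i (λ j → c j ℚ.* w j ℚ.* P j)))
         (∑-distrib-+ (λ j → u j ℚ.* R) (λ j → (ℚ.- (i ℚ.* R)) ℚ.* (c j ℚ.* w j))) ⟩
  i ℚ.* S ℚ.+ (∑ (λ j → u j ℚ.* R) ℚ.+ ∑ (λ j → (ℚ.- (i ℚ.* R)) ℚ.* (c j ℚ.* w j)))
    ≡⟨ cong₂ (λ a b → i ℚ.* S ℚ.+ (a ℚ.+ b)) (∑-convex u R (∑-uniform A′))
         (sym (*-distribˡ-sum (ℚ.- (i ℚ.* R)) (λ j → c j ℚ.* w j))) ⟩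
  i ℚ.* S ℚ.+ (R ℚ.+ (ℚ.- (i ℚ.* R)) ℚ.* Z)
    ≡⟨ cong (λ s → i ℚ.* s ℚ.+ (R ℚ.+ (ℚ.- (i ℚ.* R)) ℚ.* Z)) S≡R*Z ⟩
  i ℚ.* (R ℚ.* Z) ℚ.+ (R ℚ.+ (ℚ.- (i ℚ.* R)) ℚ.* Z)
    ≡⟨ solve 3 (λ i R Z → i :* (R :* Z) :+ (R :+ (:- (i :* R)) :* Z) := R) refl i R Z ⟩
  R ∎
  where
  open ≡-Reasoning
  open ℚ.+-*-Solver
  c u : _ → ℚ
  c = indicator A
  u = uniformOn A′
  i S Z R : ℚ
  i = inverse (∑ c)
  S = ∑ (λ j → c j ℚ.* w j ℚ.* P j)
  Z = ∑ (λ j → c j ℚ.* w j)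
  R = ∑ (λ j → conditionalOn w A′ j ℚ.* P j)
  S≡R*Z : S ≡ R ℚ.* Z
  S≡R*Z = sym (begin
    ∑ (λ j → c j ℚ.* w j ℚ.* inverse Z ℚ.* P j) ℚ.* Z
      ≡⟨ cong (ℚ._* Z) (∑-cong (λ j → solve 3 (λ a z P → a :* z :* P := a :* P :* z) refl
                                        (c j ℚ.* w j) (inverse Z) (P j))) ⟩
    ∑ (λ j → c j ℚ.* w j ℚ.* P j ℚ.* inverse Z) ℚ.* Z
      ≡⟨ cong (ℚ._* Z) (*-distribʳ-sum (inverse Z) (λ j → c j ℚ.* w j ℚ.* P j)) ⟨
    S ℚ.* inverse Z ℚ.* Z      ≡⟨ ℚ.*-assoc S (inverse Z) Z ⟩
    S ℚ.* (inverse Z ℚ.* Z)    ≡⟨ cong (S ℚ.*_) (inverse-* (∑-on-condition (moderate⇒positive wm) A′)) ⟩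
    S ℚ.* 1ℚ                   ≡⟨ ℚ.*-identityʳ S ⟩
    S                          ∎)

uniform-nonneg : ∀ {n} (A : Condition n) j → 0ℚ ℚ.≤ uniformOn A j
uniform-nonneg A′@(A , _) = normalised-nonneg (indicator A) (indicator-nonneg A) (∑-indicator A′)

simulate≤probability : ∀ {n q} (w : Fin n → ℚ) → Moderate w → ∀ K (p : Procedure n q) b →
                       simulate w K p b ℚ.≤ probability w p b
simulate≤probability w wm zero    p              b′ = probability-nonneg wm p b′
simulate≤probability w wm (suc K) (verdict b)    b′ = ℚ.≤-refl
simulate≤probability w wm (suc K) (query A next) b′ = subst (simulate w (suc K) (query A next) b′ ℚ.≤_)
  (rejection-sampling w wm A (λ j → probability w (next j) b′))
  (∑-mono λ j → *-monoˡ-≤ (uniform-nonneg A j) (ℚ.+-mono-≤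
    (*-monoˡ-≤ (ℚ.<⇒≤ (moderate⇒positive wm j)) (simulate≤probability w wm K (next j) b′))
    (*-monoˡ-≤ (0≤gap (proj₂ (wm j))) (simulate≤probability w wm K (query A next) b′))))

-- The closed form is 2 to the power q times (3/4) to the power K; it bounds the
-- probability that q answers take K rounds or more.
tail : ℕ → ℕ → ℚ
tail q       (suc K) = ¾ ℚ.* tail q K
tail zero    zero    = 1ℚ
tail (suc q) zero    = ι 2 ℚ.* tail q zero

tail-suc : ∀ q K → tail (suc q) K ≡ ι 2 ℚ.* tail q K
tail-suc q zero    = refl
tail-suc q (suc K) = trans (cong (¾ ℚ.*_) (tail-suc q K))
  (solve 3 (λ a b t → a :* (b :* t) := b :* (a :* t)) refl ¾ (ι 2) (tail q K))
  where open ℚ.+-*-Solver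

1≤tail : ∀ q → 1ℚ ℚ.≤ tail q zero
1≤tail zero    = ℚ.≤-refl
1≤tail (suc q) = ℚ.≤-trans (ℚ.≤ᵇ⇒≤ _) (*-monoˡ-≤ {ι 2} (0≤ι 2) (1≤tail q))

tail-nonneg : ∀ q K → 0ℚ ℚ.≤ tail q K
tail-nonneg q zero    = ℚ.≤-trans (ℚ.nonNegative⁻¹ 1ℚ) (1≤tail q)
tail-nonneg q (suc K) = 0≤* (ℚ.nonNegative⁻¹ ¾) (tail-nonneg q K)

-- Three rounds per answer contribute the factor 2 times 27/64, which is less than 1,
-- and ten more rounds bring the bound below 1/16.
tail-small : ∀ q → tail q (q ℕ.* 3 ℕ.+ 10) ℚ.≤ ℤ.+ 1 ℚ./ 16
tail-small zero    = ℚ.≤ᵇ⇒≤ _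
tail-small (suc q) = ℚ.≤-trans
  (≤-by-gap (c ℚ.* tail q K) (0≤* (ℚ.nonNegative⁻¹ c) (tail-nonneg q K)) (begin
    tail q K
      ≡⟨ solve 1 (λ t → t := con ¾ :* (con ¾ :* (con ¾ :* (con (ι 2) :* t))) :+ con c :* t) refl (tail q K) ⟩
    ¾ ℚ.* (¾ ℚ.* (¾ ℚ.* (ι 2 ℚ.* tail q K))) ℚ.+ c ℚ.* tail q K
      ≡⟨ cong (λ t → ¾ ℚ.* (¾ ℚ.* (¾ ℚ.* t)) ℚ.+ c ℚ.* tail q K) (tail-suc q K) ⟨
    tail (suc q) (3 ℕ.+ K) ℚ.+ c ℚ.* tail q K ∎))
  (tail-small q)
  where
  open ≡-Reasoning
  open ℚ.+-*-Solver
  K = q ℕ.* 3 ℕ.+ 10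
  c = ℤ.+ 5 ℚ./ 32

-- A round succeeds with probability w j at least 1/2, and then needs one answer less,
-- which halves the bound.  On average the bound shrinks at least by the factor
-- 3/4.
simulate-total : ∀ {n q} (w : Fin n → ℚ) → Moderate w → ∀ K (p : Procedure n q) →
                 1ℚ ℚ.- tail q K ℚ.≤ simulate w K p true ℚ.+ simulate w K p false
simulate-total {q = q} w wm zero p = ≤-by-gap (tail q 0 ℚ.- 1ℚ) (0≤gap (1≤tail q))
  (solve 1 (λ t → con 0ℚ := con 1ℚ :- t :+ (t :- con 1ℚ)) refl (tail q 0))
  where open ℚ.+-*-Solver
simulate-total {q = q} w wm (suc K) (verdict b) = ≤-by-gap (tail q (suc K)) (tail-nonneg q (suc K))
  (trans (truth-total b) (solve 1 (λ t → con 1ℚ := con 1ℚ :- t :+ t) refl (tail q (suc K))))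
  where open ℚ.+-*-Solver
simulate-total {n} {suc q} w wm (suc K) (query A next) = begin
  1ℚ ℚ.- ¾ ℚ.* tail (suc q) K
    ≡⟨ cong (λ t → 1ℚ ℚ.- ¾ ℚ.* t) (tail-suc q K) ⟩
  1ℚ ℚ.- ¾ ℚ.* (ι 2 ℚ.* t)
    ≡⟨ ∑-convex u _ (∑-uniform A) ⟨
  ∑ (λ j → u j ℚ.* (1ℚ ℚ.- ¾ ℚ.* (ι 2 ℚ.* t)))
    ≤⟨ ∑-mono (λ j → *-monoˡ-≤ (uniform-nonneg A j) (round j)) ⟩
  ∑ (λ j → u j ℚ.* (w j ℚ.* (N j true ℚ.+ N j false) ℚ.+ (1ℚ ℚ.- w j) ℚ.* (S true ℚ.+ S false)))
    ≡⟨ ∑-cong (λ j → solve 6 (λ u w a b c d →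
          u :* (w :* (a :+ b) :+ (con 1ℚ :- w) :* (c :+ d)) :=
          u :* (w :* a :+ (con 1ℚ :- w) :* c) :+ u :* (w :* b :+ (con 1ℚ :- w) :* d)) refl
          (u j) (w j) (N j true) (N j false) (S true) (S false)) ⟩
  ∑ (λ j → r j true ℚ.+ r j false)
    ≡⟨ ∑-distrib-+ (λ j → r j true) (λ j → r j false) ⟩
  simulate w (suc K) (query A next) true ℚ.+ simulate w (suc K) (query A next) false ∎
  where
  open ℚ.≤-Reasoning
  open ℚ.+-*-Solver
  t : ℚ
  t = tail q K
  u : Fin n → ℚ
  u = uniformOn A
  N : Fin n → Bool → ℚ
  N j = simulate w K (next j)
  S : Bool → ℚ
  S = simulate w K (query A next)
  r : Fin n → Bool → ℚ
  r j b = u j ℚ.* (w j ℚ.* N j b ℚ.+ (1ℚ ℚ.- w j) ℚ.* S b)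
  round : ∀ j → 1ℚ ℚ.- ¾ ℚ.* (ι 2 ℚ.* t) ℚ.≤
                w j ℚ.* (N j true ℚ.+ N j false) ℚ.+ (1ℚ ℚ.- w j) ℚ.* (S true ℚ.+ S false)
  round j = begin
    1ℚ ℚ.- ¾ ℚ.* (ι 2 ℚ.* t)
      ≤⟨ ≤-by-gap ((w j ℚ.- ½) ℚ.* t) (0≤* (0≤gap (proj₁ (wm j))) (tail-nonneg q K))
           (solve 2 (λ w t → w :* (con 1ℚ :- t) :+ (con 1ℚ :- w) :* (con 1ℚ :- con (ι 2) :* t) :=
              con 1ℚ :- con ¾ :* (con (ι 2) :* t) :+ (w :- con ½) :* t) refl (w j) t) ⟩
    w j ℚ.* (1ℚ ℚ.- t) ℚ.+ (1ℚ ℚ.- w j) ℚ.* (1ℚ ℚ.- ι 2 ℚ.* t)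
      ≡⟨ cong (λ s → w j ℚ.* (1ℚ ℚ.- t) ℚ.+ (1ℚ ℚ.- w j) ℚ.* (1ℚ ℚ.- s)) (tail-suc q K) ⟨
    w j ℚ.* (1ℚ ℚ.- t) ℚ.+ (1ℚ ℚ.- w j) ℚ.* (1ℚ ℚ.- tail (suc q) K)
      ≤⟨ ℚ.+-mono-≤
           (*-monoˡ-≤ (ℚ.<⇒≤ (moderate⇒positive wm j)) (simulate-total w wm K (next j)))
           (*-monoˡ-≤ (0≤gap (proj₂ (wm j))) (simulate-total w wm K (query A next))) ⟩
    w j ℚ.* (N j true ℚ.+ N j false) ℚ.+ (1ℚ ℚ.- w j) ℚ.* (S true ℚ.+ S false) ∎

-- Functions that cannot tell two families apart

module Fooling {r m : ℕ} (c₀ c₁ : Cube r → Cube m) where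

  -- A polynomial f of degree at most k - l in the bits has this property for families
  -- that are indistinguishable up to degree k.  Testing f against all characters
  -- of weight at most l, and not only against 1, makes the property inductive:
  -- multiplying f by one bit uses up one unit of l.
  Fooled : ℕ → (Cube m → ℚ) → Set
  Fooled l f = ∀ s → weight s ℕ.≤ l →
    avg (λ y → χ s (c₀ y) ℚ.* f (c₀ y)) ≡ avg (λ y → χ s (c₁ y) ℚ.* f (c₁ y))

  fooled-const : ∀ {k l} → Indistinguishable k c₀ c₁ → l ℕ.≤ k → ∀ p → Fooled l (λ _ → p)
  fooled-const ind l≤k p s w≤l =
    trans (pull c₀) (trans (cong (p ℚ.*_) (ind s (ℕ.≤-trans w≤l l≤k))) (sym (pull c₁)))
    where
    pull : ∀ c → avg (λ y → χ s (c y) ℚ.* p) ≡ p ℚ.* avg (χ s ∘ c)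
    pull c = trans (avg-cong (λ y → ℚ.*-comm (χ s (c y)) p)) (avg-* p (χ s ∘ c))

  fooled-+ : ∀ {l f g} → Fooled l f → Fooled l g → Fooled l (λ x → f x ℚ.+ g x)
  fooled-+ {f = f} {g} F G s w≤l =
    trans (split c₀) (trans (cong₂ ℚ._+_ (F s w≤l) (G s w≤l)) (sym (split c₁)))
    where
    split : ∀ c → avg (λ y → χ s (c y) ℚ.* (f (c y) ℚ.+ g (c y))) ≡
                  avg (λ y → χ s (c y) ℚ.* f (c y)) ℚ.+ avg (λ y → χ s (c y) ℚ.* g (c y))
    split c = trans (avg-cong (λ y → ℚ.*-distribˡ-+ (χ s (c y)) (f (c y)) (g (c y))))
                    (avg-+ (λ y → χ s (c y) ℚ.* f (c y)) (λ y → χ s (c y) ℚ.* g (c y)))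

  fooled-* : ∀ {l f} p → Fooled l f → Fooled l (λ x → p ℚ.* f x)
  fooled-* {f = f} p F s w≤l = trans (pull c₀) (trans (cong (p ℚ.*_) (F s w≤l)) (sym (pull c₁)))
    where
    open ℚ.+-*-Solver
    pull : ∀ c → avg (λ y → χ s (c y) ℚ.* (p ℚ.* f (c y))) ≡ p ℚ.* avg (λ y → χ s (c y) ℚ.* f (c y))
    pull c = trans (avg-cong (λ y → solve 3 (λ a b c → a :* (b :* c) := b :* (a :* c)) refl
                                      (χ s (c y)) p (f (c y))))
                   (avg-* p (λ y → χ s (c y) ℚ.* f (c y)))

  fooled-weaken : ∀ {l f} → Fooled (suc l) f → Fooled l f
  fooled-weaken F s w≤l = F s (ℕ.m≤n⇒m≤1+n w≤l)

  fooled-∑ : ∀ {l n} {f : Fin n → Cube m → ℚ} → (∀ j → Fooled l (f j)) →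
             Fooled l (λ x → ∑ (λ j → f j x))
  fooled-∑ {n = zero} F s w≤l = trans (zeros c₀) (sym (zeros c₁))
    where
    zeros : ∀ c → avg (λ y → χ s (c y) ℚ.* 0ℚ) ≡ 0ℚ
    zeros c = trans (avg-cong (λ y → ℚ.*-zeroʳ (χ s (c y)))) (avg-const {r} 0ℚ)
  fooled-∑ {n = suc n} {f} F = fooled-+ {f = f zero} {g = λ x → ∑ (λ j → f (suc j) x)}
    (F zero) (fooled-∑ {f = λ j → f (suc j)} (F ∘ suc))

  -- The product of two characters is a character, so the factor t is absorbed into the
  -- testing character.
  fooled-χ : ∀ {l f} t → weight t ℕ.≤ 1 → Fooled (suc l) f → Fooled l (λ x → χ t x ℚ.* f x)
  fooled-χ {l} {f} t w≤1 F s w≤l =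
    trans (absorb c₀) (trans (F (s ⊕ t) light) (sym (absorb c₁)))
    where
    light : weight (s ⊕ t) ℕ.≤ suc l
    light = ℕ.≤-trans (weight-⊕ s t) (ℕ.≤-trans (ℕ.+-mono-≤ w≤l w≤1) (ℕ.≤-reflexive (ℕ.+-comm l 1)))
    absorb : ∀ c → avg (λ y → χ s (c y) ℚ.* (χ t (c y) ℚ.* f (c y))) ≡ avg (λ y → χ (s ⊕ t) (c y) ℚ.* f (c y))
    absorb c = avg-cong λ y → trans (sym (ℚ.*-assoc (χ s (c y)) (χ t (c y)) (f (c y))))
                                    (cong (ℚ._* f (c y)) (sym (χ-⊕ˡ s t (c y))))

  fooled-cong : ∀ {l f g} → (∀ x → f x ≡ g x) → Fooled l f → Fooled l g
  fooled-cong f≡g F s w≤l = trans (avg-cong (λ y → cong (χ s (c₀ y) ℚ.*_) (sym (f≡g (c₀ y)))))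
    (trans (F s w≤l) (avg-cong (λ y → cong (χ s (c₁ y) ℚ.*_) (f≡g (c₁ y)))))

  fooled-affine : ∀ {l f} a b t → weight t ℕ.≤ 1 → Fooled (suc l) f →
                  Fooled l (λ x → (a ℚ.+ b ℚ.* χ t x) ℚ.* f x)
  fooled-affine {f = f} a b t w≤1 F = fooled-cong expand
    (fooled-+ {f = λ x → a ℚ.* f x} {g = λ x → b ℚ.* (χ t x ℚ.* f x)}
      (fooled-* {f = f} a (fooled-weaken {f = f} F))
      (fooled-* {f = λ x → χ t x ℚ.* f x} b (fooled-χ {f = f} t w≤1 F)))
    where
    open ℚ.+-*-Solver
    expand : ∀ x → a ℚ.* f x ℚ.+ b ℚ.* (χ t x ℚ.* f x) ≡ (a ℚ.+ b ℚ.* χ t x) ℚ.* f x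
    expand x = solve 4 (λ a b c f → a :* f :+ b :* (c :* f) := (a :+ b :* c) :* f) refl
                 a b (χ t x) (f x)

  fooled⇒avg : ∀ {l f} → Fooled l f → avg (f ∘ c₀) ≡ avg (f ∘ c₁)
  fooled⇒avg {f = f} F = trans (unit c₀)
    (trans (F origin (subst (ℕ._≤ _) (sym (weight-origin m)) z≤n)) (sym (unit c₁)))
    where
    unit : ∀ c → avg (f ∘ c) ≡ avg (λ y → χ origin (c y) ℚ.* f (c y))
    unit c = avg-cong λ y → sym (trans
      (cong (λ b → sign b ℚ.* f (c y)) (parity-origin (c y))) (ℚ.*-identityˡ (f (c y))))

  -- Each round multiplies by a function of a single bit, so K rounds use up K units
  -- of degree.
  simulate-fooled : ∀ {L q k} → Indistinguishable k c₀ c₁ →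
    ∀ K l → l ℕ.+ K ℕ.≤ k → (p : Procedure (m ℕ.* 2 ℕ.+ L) q) → ∀ b →
    Fooled l (λ x → simulate (weights {L = L} x) K p b)
  simulate-fooled ind zero    l l+K≤k p              b′ =
    fooled-const ind (ℕ.≤-trans (ℕ.m≤m+n l 0) l+K≤k) 0ℚ
  simulate-fooled ind (suc K) l l+K≤k (verdict b)    b′ =
    fooled-const ind (ℕ.≤-trans (ℕ.m≤m+n l (suc K)) l+K≤k) (truth b b′)
  simulate-fooled {L} {k = k} ind (suc K) l l+K≤k (query A next) b′ =
    fooled-∑ {f = λ j x → uniformOn A j ℚ.* answered j x} λ j →
      fooled-* {f = answered j} (uniformOn A j) (round j)
    where
    open ℚ.+-*-Solver
    w : Cube m → Fin (m ℕ.* 2 ℕ.+ L) → ℚ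
    w = weights
    N : Fin (m ℕ.* 2 ℕ.+ L) → Cube m → ℚ
    N j x = simulate (w x) K (next j) b′
    S : Cube m → ℚ
    S x = simulate (w x) K (query A next) b′
    answered : Fin (m ℕ.* 2 ℕ.+ L) → Cube m → ℚ
    answered j x = w x j ℚ.* N j x ℚ.+ (1ℚ ℚ.- w x j) ℚ.* S x
    bound : suc l ℕ.+ K ℕ.≤ k
    bound = subst (ℕ._≤ k) (ℕ.+-suc l K) l+K≤k
    round : ∀ j → Fooled l (answered j)
    round j with weights-affine {m} {L} j
    ... | p , t , light , affine = fooled-cong rewriteWeights
      (fooled-+ {f = λ x → (¾ ℚ.+ p ℚ.* χ t x) ℚ.* N j x} {g = λ x → (¼ ℚ.+ (ℚ.- p) ℚ.* χ t x) ℚ.* S x}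
        (fooled-affine {f = N j} ¾ p t light (simulate-fooled ind K (suc l) bound (next j) b′))
        (fooled-affine {f = S} ¼ (ℚ.- p) t light (simulate-fooled ind K (suc l) bound (query A next) b′)))
      where
      rewriteWeights : ∀ x → (¾ ℚ.+ p ℚ.* χ t x) ℚ.* N j x ℚ.+ (¼ ℚ.+ (ℚ.- p) ℚ.* χ t x) ℚ.* S x
                           ≡ answered j x
      rewriteWeights x = trans
        (cong (λ v → (¾ ℚ.+ p ℚ.* χ t x) ℚ.* N j x ℚ.+ v ℚ.* S x)
          (solve 2 (λ p c → con ¼ :+ (:- p) :* c := con 1ℚ :- (con ¾ :+ p :* c)) refl p (χ t x)))
        (cong (λ v → v ℚ.* N j x ℚ.+ (1ℚ ℚ.- v) ℚ.* S x) (sym (affine x)))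

-- Equal to 2 for a perfect distinguisher of the two families, and to 1 for a procedure
-- that ignores its samples.
success : ∀ {r m L q} (c₀ c₁ : Cube r → Cube m) → Procedure (m ℕ.* 2 ℕ.+ L) q → ℚ
success c₀ c₁ p = avg (λ y → probability (weights (c₀ y)) p true) ℚ.+
                  avg (λ y → probability (weights (c₁ y)) p false)

17/16 : ℚ
17/16 = ℤ.+ 17 ℚ./ 16

-- The probabilities of the wrong verdicts are at least the simulated ones.  The
-- simulation does not tell the families apart, so the simulated wrong verdicts
-- add up to the probability that the simulation halts, at least 15/16.
success-bound : ∀ {r m L q k} (c₀ c₁ : Cube r → Cube m) → Indistinguishable k c₀ c₁ →
  q ℕ.* 3 ℕ.+ 10 ℕ.≤ k → (p : Procedure (m ℕ.* 2 ℕ.+ L) q) → success {L = L} c₀ c₁ p ℚ.≤ 17/16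
success-bound {r} {m} {L} {q} c₀ c₁ ind K≤k p = begin
  avg (P c₀ true) ℚ.+ avg (P c₁ false)
    ≡⟨ solve 4 (λ a a′ b b′ → a :+ b′ := (a :+ a′) :+ (b :+ b′) :- (a′ :+ b)) refl
         (avg (P c₀ true)) (avg (P c₀ false)) (avg (P c₁ true)) (avg (P c₁ false)) ⟩
  (avg (P c₀ true) ℚ.+ avg (P c₀ false)) ℚ.+ (avg (P c₁ true) ℚ.+ avg (P c₁ false))
    ℚ.- (avg (P c₀ false) ℚ.+ avg (P c₁ true))
    ≡⟨ cong₂ (λ a b → a ℚ.+ b ℚ.- (avg (P c₀ false) ℚ.+ avg (P c₁ true))) (total c₀) (total c₁) ⟩
  ι 2 ℚ.- (avg (P c₀ false) ℚ.+ avg (P c₁ true))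
    ≤⟨ ℚ.+-monoʳ-≤ (ι 2) (ℚ.neg-antimono-≤ (ℚ.+-mono-≤ (below c₀ false) (below c₁ true))) ⟩
  ι 2 ℚ.- (avg (F c₀ false) ℚ.+ avg (F c₁ true))
    ≡⟨ cong (λ a → ι 2 ℚ.- (avg (F c₀ false) ℚ.+ a)) fooled ⟨
  ι 2 ℚ.- (avg (F c₀ false) ℚ.+ avg (F c₀ true))
    ≡⟨ cong (λ a → ι 2 ℚ.- a) (trans (ℚ.+-comm (avg (F c₀ false)) (avg (F c₀ true)))
                                      (sym (avg-+ (F c₀ true) (F c₀ false)))) ⟩
  ι 2 ℚ.- avg (λ y → F c₀ true y ℚ.+ F c₀ false y)
    ≤⟨ ℚ.+-monoʳ-≤ (ι 2) (ℚ.neg-antimono-≤ (avg-mono (λ y →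
         ℚ.≤-trans halts (simulate-total (weights (c₀ y)) (weights-bounds (c₀ y)) K p)))) ⟩
  ι 2 ℚ.- avg {r} (λ _ → ℤ.+ 15 ℚ./ 16)
    ≡⟨ cong (λ a → ι 2 ℚ.- a) (avg-const {r} (ℤ.+ 15 ℚ./ 16)) ⟩
  17/16 ∎
  where
  open ℚ.≤-Reasoning
  open ℚ.+-*-Solver
  K : ℕ
  K = q ℕ.* 3 ℕ.+ 10
  P F : (Cube r → Cube m) → Bool → Cube r → ℚ
  P c b y = probability (weights {L = L} (c y)) p b
  F c b y = simulate (weights {L = L} (c y)) K p b
  total : ∀ c → avg (P c true) ℚ.+ avg (P c false) ≡ 1ℚ
  total c = trans (sym (avg-+ (P c true) (P c false)))
    (trans (avg-cong (λ y → probability-total (weights-bounds (c y)) p)) (avg-const {r} 1ℚ))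
  below : ∀ c b → avg (F c b) ℚ.≤ avg (P c b)
  below c b = avg-mono λ y → simulate≤probability (weights (c y)) (weights-bounds (c y)) K p b
  fooled : avg (F c₀ true) ≡ avg (F c₁ true)
  fooled = Fooling.fooled⇒avg c₀ c₁ {l = 0} {f = λ x → simulate (weights x) K p true}
             (Fooling.simulate-fooled c₀ c₁ ind K 0 K≤k p true)
  halts : ℤ.+ 15 ℚ./ 16 ℚ.≤ 1ℚ ℚ.- tail q K
  halts = ℚ.+-monoʳ-≤ 1ℚ (ℚ.neg-antimono-≤ (tail-small q))

-- Real numbers

eventually-× : ∀ {P Q : ℕ → Set} → Eventually P → Eventually Q → Eventually λ N → P N × Q N
eventually-× (M , p) (N , q) =
  M ℕ.⊔ N , λ n M⊔N≤n → p n (ℕ.m⊔n≤o⇒m≤o M N M⊔N≤n) , q n (ℕ.m⊔n≤o⇒n≤o M N M⊔N≤n)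

eventually-map : ∀ {P Q : ℕ → Set} → (∀ N → P N → Q N) → Eventually P → Eventually Q
eventually-map f (N , p) = N , λ n N≤n → f n (p n N≤n)

eventually-cube : ∀ {r} {P : Cube r → ℕ → Set} → (∀ y → Eventually (P y)) →
                  Eventually λ N → ∀ y → P y N
eventually-cube {zero}  ev = eventually-map (λ { N p [] → p }) (ev [])
eventually-cube {suc r} ev = eventually-map
  (λ { N (p , q) (false ∷ y) → p y ; N (p , q) (true ∷ y) → q y })
  (eventually-× (eventually-cube (ev ∘ (false ∷_))) (eventually-cube (ev ∘ (true ∷_))))

seq-sum : ∀ {n} (f : Fin n → ℝ) N → seq (sum f) N ≡ ∑ (λ i → seq (f i) N)
seq-sum {zero}  f N = refl
seq-sum {suc n} f N = cong (seq (f zero) N ℚ.+_) (seq-sum (f ∘ suc) N)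

pointwise-≃ : ∀ {x y} → (∀ N → seq x N ≡ seq y N) → x ≃ y
pointwise-≃ {x} {y} x≡y ε 0<ε = 0 , λ N _ → subst (ℚ._< ε)
  (sym (cong ℚ.∣_∣ (trans (cong (ℚ._- seq y N) (x≡y N)) (ℚ.+-inverseʳ (seq y N))))) 0<ε

pointwise-≤ : ∀ {x y} → (∀ N → seq x N ℚ.≤ seq y N) → x ≤ y
pointwise-≤ x≤y ε 0<ε = 0 , λ N _ → ℚ.≤-trans (x≤y N) (≤-by-gap ε (ℚ.<⇒≤ 0<ε) refl)

+-mono-≤ : ∀ {x y z w} → x ≤ y → z ≤ w → x + z ≤ y + w
+-mono-≤ {x} {y} {z} {w} x≤y z≤w ε 0<ε = eventually-map
  (λ N (p , q) → subst (seq x N ℚ.+ seq z N ℚ.≤_) (regroup N) (ℚ.+-mono-≤ p q))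
  (eventually-× (x≤y _ (0<½ε 0<ε)) (z≤w _ (0<½ε 0<ε)))
  where
  open ℚ.+-*-Solver
  regroup : ∀ N → (seq y N ℚ.+ ½ ℚ.* ε) ℚ.+ (seq w N ℚ.+ ½ ℚ.* ε) ≡ (seq y N ℚ.+ seq w N) ℚ.+ ε
  regroup N = trans
    (solve 3 (λ a b h → (a :+ h) :+ (b :+ h) := (a :+ b) :+ (h :+ h)) refl (seq y N) (seq w N) (½ ℚ.* ε))
    (cong ((seq y N ℚ.+ seq w N) ℚ.+_) (½ε+½ε≡ε ε))

sum-mono-≤ : ∀ {n} {f g : Fin n → ℝ} → (∀ i → f i ≤ g i) → sum f ≤ sum g
sum-mono-≤ {zero}          f≤g = pointwise-≤ {0ℝ} {0ℝ} λ _ → ℚ.≤-refl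
sum-mono-≤ {suc n} {f} {g} f≤g =
  +-mono-≤ {f zero} {g zero} {sum (f ∘ suc)} {sum (g ∘ suc)} (f≤g zero) (sum-mono-≤ (f≤g ∘ suc))

-- A real x with 0 ≤ x may have slightly negative approximations, by at most η; the
-- factor K rescales η to the allowance.
*-fromℚ-mono-≤ : ∀ {x p q} → 0ℝ ≤ x → p ℚ.≤ q → x * fromℚ p ≤ x * fromℚ q
*-fromℚ-mono-≤ {x} {p} {q} 0≤x p≤q ε 0<ε = eventually-map bound (0≤x η 0<η)
  where
  K : ℚ
  K = 1ℚ ℚ.+ (q ℚ.- p)
  scale : ∃ λ η → 0ℚ ℚ.< η × K ℚ.* η ≡ ε
  scale = rescale K (ℚ.pos+nonNeg⇒pos 1ℚ (q ℚ.- p) {{ℚ.nonNegative (0≤gap p≤q)}}) ε 0<ε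
  η : ℚ
  η = proj₁ scale
  0<η : 0ℚ ℚ.< η
  0<η = proj₁ (proj₂ scale)
  bound : ∀ N → 0ℚ ℚ.≤ seq x N ℚ.+ η → seq x N ℚ.* p ℚ.≤ seq x N ℚ.* q ℚ.+ ε
  bound N 0≤x+η = ≤-by-gap ((seq x N ℚ.+ η) ℚ.* (q ℚ.- p) ℚ.+ η)
    (0≤+ (0≤* 0≤x+η (0≤gap p≤q)) (ℚ.<⇒≤ 0<η))
    (trans (cong (seq x N ℚ.* q ℚ.+_) (sym (proj₂ (proj₂ scale))))
      (solve 4 (λ x p q η → x :* q :+ (con 1ℚ :+ (q :- p)) :* η :=
                            x :* p :+ ((x :+ η) :* (q :- p) :+ η)) refl (seq x N) p q η))
    where open ℚ.+-*-Solver

-- The allowance is halved at each summand, so that no division by n is needed.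
∑-vanishes : ∀ {n} (e : Fin n → ℕ → ℚ) → (∀ i ε → 0ℚ ℚ.< ε → Eventually λ N → e i N ℚ.< ε) →
             ∀ ε → 0ℚ ℚ.< ε → Eventually λ N → ∑ (λ i → e i N) ℚ.≤ ε
∑-vanishes {zero}  e small ε 0<ε = 0 , λ _ _ → ℚ.<⇒≤ 0<ε
∑-vanishes {suc n} e small ε 0<ε = eventually-map
  (λ N (p , q) → ℚ.≤-trans (ℚ.+-mono-≤ (ℚ.<⇒≤ p) q) (ℚ.≤-reflexive (½ε+½ε≡ε ε)))
  (eventually-× (small zero _ (0<½ε 0<ε)) (∑-vanishes (e ∘ suc) (small ∘ suc) _ (0<½ε 0<ε)))

seq-d : ∀ {n} (μ ν : Distribution n) N →
        seq (d μ ν) N ≡ ½ ℚ.* ∑ (λ i → ℚ.∣ seq (mass μ i) N ℚ.- seq (mass ν i) N ∣)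
seq-d μ ν N = cong (½ ℚ.*_) (seq-sum (λ i → ∣ mass μ i - mass ν i ∣ℝ) N)

-- The triangle inequality: replacing μ by ν costs half the sum of the differences
-- of their masses, which vanishes in the limit.
d-respects-≈ : ∀ {n ε} (ξ μ ν : Distribution n) → μ ≈ ν → ε ≤ d ξ μ → ε ≤ d ξ ν
d-respects-≈ {n} {ε} ξ μ ν μ≈ν ε≤d η 0<η = eventually-map close-enough
  (eventually-× (ε≤d _ (0<½ε 0<η)) (∑-vanishes (λ i N → ℚ.∣ m i N ℚ.- v i N ∣) μ≈ν η 0<η))
  where
  x m v : Fin n → ℕ → ℚ
  x i = seq (mass ξ i)
  m i = seq (mass μ i)
  v i = seq (mass ν i)
  triangle : ∀ a b c → ℚ.∣ a ℚ.- b ∣ ℚ.≤ ℚ.∣ a ℚ.- c ∣ ℚ.+ ℚ.∣ b ℚ.- c ∣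
  triangle a b c = subst (λ t → ℚ.∣ t ∣ ℚ.≤ ℚ.∣ a ℚ.- c ∣ ℚ.+ ℚ.∣ b ℚ.- c ∣)
    (solve 3 (λ a b c → (a :- c) :- (b :- c) := a :- b) refl a b c)
    (ℚ.∣p-q∣≤∣p∣+∣q∣ (a ℚ.- c) (b ℚ.- c))
    where open ℚ.+-*-Solver
  open ℚ.≤-Reasoning
  close-enough : ∀ N → seq ε N ℚ.≤ seq (d ξ μ) N ℚ.+ ½ ℚ.* η × ∑ (λ i → ℚ.∣ m i N ℚ.- v i N ∣) ℚ.≤ η →
             seq ε N ℚ.≤ seq (d ξ ν) N ℚ.+ η
  close-enough N (p , e≤η) = begin
    seq ε N
      ≤⟨ p ⟩
    seq (d ξ μ) N ℚ.+ ½ ℚ.* η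
      ≡⟨ cong (ℚ._+ ½ ℚ.* η) (seq-d ξ μ N) ⟩
    ½ ℚ.* ∑ (λ i → ℚ.∣ x i N ℚ.- m i N ∣) ℚ.+ ½ ℚ.* η
      ≤⟨ ℚ.+-monoˡ-≤ (½ ℚ.* η) (*-monoˡ-≤ {½} (ℚ.nonNegative⁻¹ ½)
           (∑-mono (λ i → triangle (x i N) (m i N) (v i N)))) ⟩
    ½ ℚ.* ∑ (λ i → ℚ.∣ x i N ℚ.- v i N ∣ ℚ.+ ℚ.∣ m i N ℚ.- v i N ∣) ℚ.+ ½ ℚ.* η
      ≡⟨ cong (λ t → ½ ℚ.* t ℚ.+ ½ ℚ.* η)
           (∑-distrib-+ (λ i → ℚ.∣ x i N ℚ.- v i N ∣) (λ i → ℚ.∣ m i N ℚ.- v i N ∣)) ⟩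
    ½ ℚ.* (S ℚ.+ E) ℚ.+ ½ ℚ.* η
      ≤⟨ ℚ.+-monoˡ-≤ (½ ℚ.* η) (*-monoˡ-≤ {½} (ℚ.nonNegative⁻¹ ½) (ℚ.+-monoʳ-≤ S e≤η)) ⟩
    ½ ℚ.* (S ℚ.+ η) ℚ.+ ½ ℚ.* η
      ≡⟨ solve 3 (λ h s e → h :* (s :+ e) :+ h :* e := h :* s :+ (h :* e :+ h :* e)) refl ½ S η ⟩
    ½ ℚ.* S ℚ.+ (½ ℚ.* η ℚ.+ ½ ℚ.* η)
      ≡⟨ cong₂ ℚ._+_ (sym (seq-d ξ ν N)) (½ε+½ε≡ε η) ⟩
    seq (d ξ ν) N ℚ.+ η ∎
    where
    open ℚ.+-*-Solver
    S E : ℚ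
    S = ∑ (λ i → ℚ.∣ x i N ℚ.- v i N ∣)
    E = ∑ (λ i → ℚ.∣ m i N ℚ.- v i N ∣)

-- Rational distributions

rational : ∀ {n} (p : Fin n → ℚ) → (∀ i → 0ℚ ℚ.≤ p i) → ∑ p ≡ 1ℚ → Distribution n
rational p 0≤p ∑p≡1 = record
  { mass     = λ i → fromℚ (p i)
  ; nonneg   = λ i → pointwise-≤ {0ℝ} {fromℚ (p i)} λ _ → 0≤p i
  ; sums-to1 = pointwise-≃ {sum (λ i → fromℚ (p i))} {1ℝ} λ N → trans (seq-sum (λ i → fromℚ (p i)) N) ∑p≡1
  }

conditionalDistribution : ∀ {n} (w : Fin n → ℚ) → Moderate w → Condition n → Distribution n
conditionalDistribution w wm A =
  rational (conditionalOn w A) (conditional-nonneg wm A) (∑-conditional w (moderate⇒positive wm) A)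

weighted : ∀ {n} (w : Fin n → ℚ) → Moderate w → 0ℚ ℚ.< ∑ w → Distribution n
weighted w wm 0<∑ = rational (normalised w)
  (normalised-nonneg w (λ j → ℚ.<⇒≤ (moderate⇒positive wm j)) 0<∑) (∑-normalised w 0<∑)

module _ {n : ℕ} (w : Fin n → ℚ) (wm : Moderate w) (0<∑ : 0ℚ ℚ.< ∑ w) where

  private
    Z : Subset n → ℚ
    Z A = ∑ (λ j → indicator A j ℚ.* w j)
    z : ℚ
    z = inverse (∑ w)

  -- The approximations of the mass of A are constant, as all masses are rational.
  seq-massOn : ∀ A N → seq (massOn (weighted w wm 0<∑) A) N ≡ Z A ℚ.* z
  seq-massOn A N = begin
    seq (massOn (weighted w wm 0<∑) A) N
      ≡⟨ seq-sum (λ j → if lookup A j then fromℚ (w j ℚ.* z) else 0ℝ) N ⟩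
    ∑ (λ j → seq (if lookup A j then fromℚ (w j ℚ.* z) else 0ℝ) N)
      ≡⟨ ∑-cong (λ j → cases (lookup A j) (w j)) ⟩
    ∑ (λ j → indicator A j ℚ.* w j ℚ.* z)
      ≡⟨ *-distribʳ-sum z (λ j → indicator A j ℚ.* w j) ⟨
    Z A ℚ.* z ∎
    where
    open ≡-Reasoning
    cases : ∀ b p → seq (if b then fromℚ (p ℚ.* z) else 0ℝ) N ≡ (if b then 1ℚ else 0ℚ) ℚ.* p ℚ.* z
    cases true  p = cong (ℚ._* z) (sym (ℚ.*-identityˡ p))
    cases false p = sym (trans (cong (ℚ._* z) (ℚ.*-zeroˡ p)) (ℚ.*-zeroˡ z))

  -- All weights are positive, so every condition has positive mass.
  oracle : Oracle (weighted w wm 0<∑)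
  oracle = record
    { answer      = conditionalDistribution w wm
    ; outside     = λ { (A , ne) j j∉A → pointwise-≃ {fromℚ (conditionalOn w (A , ne) j)} {0ℝ}
                          λ _ → vanishes A j (lookup A j) refl j∉A }
    ; conditioned = λ { (A , ne) j j∈A _ →
        pointwise-≃ {fromℚ (conditionalOn w (A , ne) j) * massOn (weighted w wm 0<∑) A} {fromℚ (normalised w j)}
          λ N → trans (cong (conditionalOn w (A , ne) j ℚ.*_) (seq-massOn A N)) (ratio (A , ne) j (Vec.[]=⇒lookup j∈A)) }
    ; uniform     = λ { (A , ne) j j∈A null → contradiction null (charged (A , ne)) }
    }
    where
    vanishes : ∀ A j b → lookup A j ≡ b → j Subset.∉ A → indicator A j ℚ.* w j ℚ.* inverse (Z A) ≡ 0ℚ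
    vanishes A j true  eq j∉A = contradiction (Vec.lookup⇒[]= j A eq) j∉A
    vanishes A j false eq j∉A rewrite eq = trans (cong (ℚ._* inverse (Z A)) (ℚ.*-zeroˡ (w j)))
                                                 (ℚ.*-zeroˡ (inverse (Z A)))
    0<Z : ∀ ((A , _) : Condition n) → 0ℚ ℚ.< Z A
    0<Z = ∑-on-condition (moderate⇒positive wm)
    ratio : ∀ ((A , ne) : Condition n) j → lookup A j ≡ true →
            conditionalOn w (A , ne) j ℚ.* (Z A ℚ.* z) ≡ normalised w j
    ratio (A , ne) j eq rewrite eq = trans
      (solve 4 (λ w i Z z → con 1ℚ :* w :* i :* (Z :* z) := (i :* Z) :* (w :* z)) refl
         (w j) (inverse (Z A)) (Z A) z)
      (trans (cong (ℚ._* (w j ℚ.* z)) (inverse-* (0<Z (A , ne)))) (ℚ.*-identityˡ (w j ℚ.* z)))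
      where open ℚ.+-*-Solver
    charged : ∀ ((A , _) : Condition n) → ¬ (massOn (weighted w wm 0<∑) A ≃ 0ℝ)
    charged (A , ne) null with null (Z A ℚ.* z) (0<* (0<Z (A , ne)) (0<inverse 0<∑))
    ... | N , small = ℚ.<-irrefl (trans (cong (λ t → ℚ.∣ t ℚ.- 0ℚ ∣) (seq-massOn A N))
                        (trans (cong ℚ.∣_∣ (ℚ.+-identityʳ (Z A ℚ.* z)))
                          (ℚ.0≤p⇒∣p∣≡p (ℚ.<⇒≤ (0<* (0<Z (A , ne)) (0<inverse 0<∑))))))
                        (small N ℕ.≤-refl)

  seq-outcomeProb : ∀ {q} (p : Procedure n q) b N → seq (outcomeProb oracle p b) N ≡ probability w p b
  seq-outcomeProb (verdict true)  true  N = refl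
  seq-outcomeProb (verdict true)  false N = refl
  seq-outcomeProb (verdict false) true  N = refl
  seq-outcomeProb (verdict false) false N = refl
  seq-outcomeProb (query A next)  b     N = trans
    (seq-sum (λ j → fromℚ (conditionalOn w A j) * outcomeProb oracle (next j) b) N)
    (∑-cong (λ j → cong (conditionalOn w A j ℚ.*_) (seq-outcomeProb (next j) b N)))

  seq-Pr : ∀ {q} (T : AdaptiveAlgorithm n q) b N → let open AdaptiveAlgorithm T in
    seq (Pr[ T on oracle outputs b ]) N ≡ ∑ (λ r → seq (mass coins r) N ℚ.* probability w (run r) b)
  seq-Pr T b N = trans (seq-sum (λ r → mass coins r * outcomeProb oracle (run r) b) N)
    (∑-cong (λ r → cong (seq (mass coins r) N ℚ.*_) (seq-outcomeProb (run r) b N)))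
    where open AdaptiveAlgorithm T

weights-positive : ∀ {s L} (x : Cube (suc s)) → 0ℚ ℚ.< ∑ (weights {L = L} x)
weights-positive x = ∑-positive (λ j → ℚ.<⇒≤ (moderate⇒positive (weights-bounds x) j)) zero
                       (moderate⇒positive (weights-bounds x) zero)

encoded : ∀ {s L} → Cube (suc s) → Distribution (suc s ℕ.* 2 ℕ.+ L)
encoded x = weighted (weights x) (weights-bounds x) (weights-positive x)

encodedOracle : ∀ {s L} (x : Cube (suc s)) → Oracle (encoded {L = L} x)
encodedOracle x = oracle (weights x) (weights-bounds x) (weights-positive x)

1/96 : ℚ
1/96 = ℤ.+ 1 ℚ./ 96

-- Half the sum of the differences is half the Hamming distance divided by the total
-- weight, which is three quarters of n and hence at most 48 t.
encoded-far : ∀ {m L t} (x y : Cube (suc m)) → suc m ℕ.* 2 ℕ.+ L ℕ.≤ t ℕ.* 64 → t ℕ.≤ weight (x ⊕ y) →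
              fromℚ 1/96 ≤ d (encoded {L = L} x) (encoded y)
encoded-far {m} {L} {t} x y n≤64t t≤w = pointwise-≤ {fromℚ 1/96} {d (encoded x) (encoded y)} λ N →
  subst (1/96 ℚ.≤_) (sym (seq-d (encoded x) (encoded y) N)) (begin
    1/96
      ≡⟨ cong (1/96 ℚ.*_) (inverse-* 0<total) ⟨
    1/96 ℚ.* (z ℚ.* (¾ ℚ.* ι n))
      ≤⟨ *-monoˡ-≤ {1/96} (ℚ.nonNegative⁻¹ 1/96) (*-monoˡ-≤ {z} 0≤z (*-monoˡ-≤ {¾} (ℚ.nonNegative⁻¹ ¾)
           (ℚ.≤-trans (ι-mono n≤64t) (ℚ.≤-reflexive (ι-* t 64))))) ⟩
    1/96 ℚ.* (z ℚ.* (¾ ℚ.* (ι t ℚ.* ι 64)))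
      ≡⟨ solve 2 (λ z t → con 1/96 :* (z :* (con ¾ :* (t :* con (ι 64)))) := con ½ :* (t :* z)) refl z (ι t) ⟩
    ½ ℚ.* (ι t ℚ.* z)
      ≤⟨ *-monoˡ-≤ {½} (ℚ.nonNegative⁻¹ ½)
           (ℚ.*-monoʳ-≤-nonNeg z {{ℚ.nonNegative 0≤z}} (ι-mono t≤w)) ⟩
    ½ ℚ.* (ι (weight (x ⊕ y)) ℚ.* z)
      ≡⟨ cong (λ a → ½ ℚ.* (a ℚ.* z)) (weights-distance x y) ⟨
    ½ ℚ.* (∑ (λ j → ℚ.∣ weights x j ℚ.- weights y j ∣) ℚ.* z)
      ≡⟨ cong (½ ℚ.*_) (*-distribʳ-sum z (λ j → ℚ.∣ weights x j ℚ.- weights y j ∣)) ⟩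
    ½ ℚ.* ∑ (λ j → ℚ.∣ weights x j ℚ.- weights y j ∣ ℚ.* z)
      ≡⟨ cong (½ ℚ.*_) (∑-cong (λ j → scaled (weights x j) (weights y j))) ⟩
    ½ ℚ.* ∑ (λ j → ℚ.∣ normalised (weights x) j ℚ.- normalised (weights y) j ∣) ∎)
  where
  open ℚ.≤-Reasoning
  open ℚ.+-*-Solver
  n : ℕ
  n = suc m ℕ.* 2 ℕ.+ L
  z : ℚ
  z = inverse (¾ ℚ.* ι n)
  0<total : 0ℚ ℚ.< ¾ ℚ.* ι n
  0<total = subst (0ℚ ℚ.<_) (∑-weights {L = L} x) (weights-positive {L = L} x)
  0≤z : 0ℚ ℚ.≤ z
  0≤z = ℚ.<⇒≤ (0<inverse 0<total)
  scaled : ∀ a b → ℚ.∣ a ℚ.- b ∣ ℚ.* z ≡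
           ℚ.∣ a ℚ.* inverse (∑ (weights {L = L} x)) ℚ.- b ℚ.* inverse (∑ (weights {L = L} y)) ∣
  scaled a b = trans (cong (ℚ.∣ a ℚ.- b ∣ ℚ.*_) (sym (ℚ.0≤p⇒∣p∣≡p 0≤z)))
    (trans (sym (ℚ.∣p*q∣≡∣p∣*∣q∣ (a ℚ.- b) z))
      (trans (cong ℚ.∣_∣ (solve 3 (λ a b z → (a :- b) :* z := a :* z :- b :* z) refl a b z))
        (cong₂ (λ s t → ℚ.∣ a ℚ.* inverse s ℚ.- b ℚ.* inverse t ∣)
           (sym (∑-weights {L = L} x)) (sym (∑-weights {L = L} y)))))

-- Defined so that the points of ξ are far from the property by definition.
farFrom : ∀ {r n} → ℝ → (Cube r → Distribution n) → Property n
farFrom ε ξ = record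
  { holds    = λ μ → ∀ y → ε ≤ d (ξ y) μ
  ; respects = λ {μ} {ν} μ≈ν far y → d-respects-≈ {ε = ε} (ξ y) μ ν μ≈ν (far y)
  }

-- A tester succeeds with probability 2/3 on both families, so the expectation of
-- success over the coins is at least 4/3, but it is at most 17/16 if the
-- simulation fits into degree k.  The contradiction is obtained at a single
-- index N of the Cauchy sequences at which all the finitely many estimates
-- involved hold up to η.
tester-needs-samples : ∀ {r m L q k ε} (c₀ c₁ : Cube r → Cube (suc m)) → Indistinguishable k c₀ c₁ →
  (P : Property (suc m ℕ.* 2 ℕ.+ L)) →
  (∀ y → holds P (encoded (c₀ y))) → (∀ y → Far ε P (encoded (c₁ y))) →
  (T : AdaptiveAlgorithm (suc m ℕ.* 2 ℕ.+ L) q) → IsAdaptiveTester P ε ⅓ℝ T → k ℕ.< q ℕ.* 3 ℕ.+ 10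
tester-needs-samples {r} {m} {L} {q} {k} {ε} c₀ c₁ ind P inside far T tester = ℕ.≰⇒> λ K≤k →
  absurd K≤k (eventually-× (eventually-cube accepting) (eventually-× (eventually-cube rejecting)
    (eventually-× (coinBound K≤k η 0<η) (sums-to1 coins η 0<η))))
  where
  open AdaptiveAlgorithm T
  open IsAdaptiveTester tester
  -- Small enough for 17/16 times 1 + η, plus 3 η, to stay below 4/3.
  η : ℚ
  η = ℤ.+ 1 ℚ./ 16
  0<η : 0ℚ ℚ.< η
  0<η = ℚ.positive⁻¹ η
  2/3 : ℚ
  2/3 = ℤ.+ 2 ℚ./ 3
  coin : Fin seeds → ℕ → ℚ
  coin s = seq (mass coins s)
  G : Fin seeds → ℚ
  G s = success {L = L} c₀ c₁ (run s)
  prob : (Cube r → Cube (suc m)) → Bool → Cube r → Fin seeds → ℚ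
  prob c b y s = probability (weights {L = L} (c y)) (run s) b
  accepting : ∀ y → Eventually λ N → 2/3 ℚ.≤ ∑ (λ s → coin s N ℚ.* prob c₀ true y s) ℚ.+ η
  accepting y = eventually-map
    (λ N → subst (λ p → 2/3 ℚ.≤ p ℚ.+ η)
      (seq-Pr (weights (c₀ y)) (weights-bounds (c₀ y)) (weights-positive (c₀ y)) T true N))
    (accepts (encoded (c₀ y)) (inside y) (encodedOracle (c₀ y)) η 0<η)
  rejecting : ∀ y → Eventually λ N → 2/3 ℚ.≤ ∑ (λ s → coin s N ℚ.* prob c₁ false y s) ℚ.+ η
  rejecting y = eventually-map
    (λ N → subst (λ p → 2/3 ℚ.≤ p ℚ.+ η)
      (seq-Pr (weights (c₁ y)) (weights-bounds (c₁ y)) (weights-positive (c₁ y)) T false N))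
    (rejects (encoded (c₁ y)) (far y) (encodedOracle (c₁ y)) η 0<η)
  coinBound : q ℕ.* 3 ℕ.+ 10 ℕ.≤ k →
              sum (λ s → mass coins s * fromℚ (G s)) ≤ sum (λ s → mass coins s * fromℚ 17/16)
  coinBound K≤k = sum-mono-≤ {f = λ s → mass coins s * fromℚ (G s)} {g = λ s → mass coins s * fromℚ 17/16}
    λ s → *-fromℚ-mono-≤ {mass coins s} (nonneg coins s) (success-bound c₀ c₁ ind K≤k (run s))
  averaged : ∀ c b N → (∀ y → 2/3 ℚ.≤ ∑ (λ s → coin s N ℚ.* prob c b y s) ℚ.+ η) →
             2/3 ℚ.≤ ∑ (λ s → coin s N ℚ.* avg (λ y → prob c b y s)) ℚ.+ η
  averaged c b N bound = begin
    2/3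
      ≡⟨ avg-const {r} 2/3 ⟨
    avg {r} (λ _ → 2/3)
      ≤⟨ avg-mono bound ⟩
    avg (λ y → ∑ (λ s → coin s N ℚ.* prob c b y s) ℚ.+ η)
      ≡⟨ avg-+ (λ y → ∑ (λ s → coin s N ℚ.* prob c b y s)) (λ _ → η) ⟩
    avg (λ y → ∑ (λ s → coin s N ℚ.* prob c b y s)) ℚ.+ avg {r} (λ _ → η)
      ≡⟨ cong₂ ℚ._+_ (avg-∑ (λ s y → coin s N ℚ.* prob c b y s)) (avg-const {r} η) ⟩
    ∑ (λ s → avg (λ y → coin s N ℚ.* prob c b y s)) ℚ.+ η
      ≡⟨ cong (ℚ._+ η) (∑-cong (λ s → avg-* (coin s N) (λ y → prob c b y s))) ⟩
    ∑ (λ s → coin s N ℚ.* avg (λ y → prob c b y s)) ℚ.+ η ∎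
    where open ℚ.≤-Reasoning
  absurd : q ℕ.* 3 ℕ.+ 10 ℕ.≤ k → ¬ (Eventually λ N →
    (∀ y → 2/3 ℚ.≤ ∑ (λ s → coin s N ℚ.* prob c₀ true y s) ℚ.+ η) ×
    (∀ y → 2/3 ℚ.≤ ∑ (λ s → coin s N ℚ.* prob c₁ false y s) ℚ.+ η) ×
    seq (sum (λ s → mass coins s * fromℚ (G s))) N ℚ.≤ seq (sum (λ s → mass coins s * fromℚ 17/16)) N ℚ.+ η ×
    ℚ.∣ seq (sum (mass coins)) N ℚ.- 1ℚ ∣ ℚ.< η)
  absurd K≤k (N , at) with at N ℕ.≤-refl
  ... | acc , rej , upper , total = toWitnessFalse
    {a? = 2/3 ℚ.+ 2/3 ℚ.≤? (1ℚ ℚ.+ η) ℚ.* 17/16 ℚ.+ η ℚ.+ (η ℚ.+ η)} _ (begin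
    2/3 ℚ.+ 2/3
      ≤⟨ ℚ.+-mono-≤ (averaged c₀ true N acc) (averaged c₁ false N rej) ⟩
    (A ℚ.+ η) ℚ.+ (R ℚ.+ η)
      ≡⟨ solve 3 (λ a r e → (a :+ e) :+ (r :+ e) := (a :+ r) :+ (e :+ e)) refl A R η ⟩
    (A ℚ.+ R) ℚ.+ (η ℚ.+ η)
      ≡⟨ cong (ℚ._+ (η ℚ.+ η)) (trans
           (sym (∑-distrib-+ (λ s → coin s N ℚ.* avg (λ y → prob c₀ true y s))
                             (λ s → coin s N ℚ.* avg (λ y → prob c₁ false y s))))
           (trans (∑-cong (λ s → sym (ℚ.*-distribˡ-+ (coin s N) (avg (λ y → prob c₀ true y s))
                                                                 (avg (λ y → prob c₁ false y s)))))
             (sym (seq-sum (λ s → mass coins s * fromℚ (G s)) N)))) ⟩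
    seq (sum (λ s → mass coins s * fromℚ (G s))) N ℚ.+ (η ℚ.+ η)
      ≤⟨ ℚ.+-monoˡ-≤ (η ℚ.+ η) upper ⟩
    (seq (sum (λ s → mass coins s * fromℚ 17/16)) N ℚ.+ η) ℚ.+ (η ℚ.+ η)
      ≡⟨ cong (λ t → (t ℚ.+ η) ℚ.+ (η ℚ.+ η)) (trans (seq-sum (λ s → mass coins s * fromℚ 17/16) N)
           (trans (sym (*-distribʳ-sum 17/16 (λ s → coin s N))) (cong (ℚ._* 17/16) (sym (seq-sum (mass coins) N))))) ⟩
    (C ℚ.* 17/16 ℚ.+ η) ℚ.+ (η ℚ.+ η)
      ≤⟨ ℚ.+-monoˡ-≤ (η ℚ.+ η) (ℚ.+-monoˡ-≤ η (ℚ.*-monoʳ-≤-nonNeg 17/16 C≤1+η)) ⟩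
    ((1ℚ ℚ.+ η) ℚ.* 17/16 ℚ.+ η) ℚ.+ (η ℚ.+ η) ∎)
    where
    open ℚ.≤-Reasoning
    open ℚ.+-*-Solver
    A R C : ℚ
    A = ∑ (λ s → coin s N ℚ.* avg (λ y → prob c₀ true y s))
    R = ∑ (λ s → coin s N ℚ.* avg (λ y → prob c₁ false y s))
    C = seq (sum (mass coins)) N
    p≤∣p∣ : ∀ p → p ℚ.≤ ℚ.∣ p ∣
    p≤∣p∣ p with ℚ.≤-total 0ℚ p
    ... | inj₁ 0≤p = ℚ.≤-reflexive (sym (ℚ.0≤p⇒∣p∣≡p 0≤p))
    ... | inj₂ p≤0 = ℚ.≤-trans p≤0 (ℚ.0≤∣p∣ p)
    C≤1+η : C ℚ.≤ 1ℚ ℚ.+ η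
    C≤1+η = begin
      C                     ≡⟨ solve 1 (λ c → c := con 1ℚ :+ (c :- con 1ℚ)) refl C ⟩
      1ℚ ℚ.+ (C ℚ.- 1ℚ)     ≤⟨ ℚ.+-monoʳ-≤ 1ℚ (ℚ.≤-trans (p≤∣p∣ (C ℚ.- 1ℚ)) (ℚ.<⇒≤ total)) ⟩
      1ℚ ℚ.+ η              ∎

-- The hard properties

-- Dimension 7 s in length 16 s: the dimension exceeds 6 s, the logarithm of the
-- volume of a ball of radius s, which gives dual distance greater than s, and
-- 7 s + 6 s is less than 16 s, which leaves a point at distance greater than s.
HardCode : ℕ → Set
HardCode s = ∃ λ (G : Vec (Cube (s ℕ.* 7)) (s ℕ.* 16)) → IndependentColumns s G ×
             ∃ λ (u : Cube (s ℕ.* 16)) → ∀ y → s ℕ.< weight (encode G y ⊕ u)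

hardCode : ∀ s → HardCode (suc s)
hardCode s′ =
  let s = suc s′
      exponents : ∀ {a b} → a ℕ.< b → 2 ℕ.^ (s ℕ.* a) ℕ.< 2 ℕ.^ (s ℕ.* b)
      exponents a<b = ℕ.^-monoʳ-< 2 (s≤s (s≤s z≤n)) (ℕ.*-monoʳ-< s a<b)
      G , independent = gilbertVarshamov (s ℕ.* 16) s
        (ℕ.≤-<-trans (volume-linear s) (exponents (ℕ.≤ᵇ⇒≤ 7 7 _)))
      u , far = farPoint G s (begin-strict
        2 ℕ.^ (s ℕ.* 7) ℕ.* volume (s ℕ.* 16) s  ≤⟨ ℕ.*-monoʳ-≤ (2 ℕ.^ (s ℕ.* 7)) (volume-linear s) ⟩
        2 ℕ.^ (s ℕ.* 7) ℕ.* 2 ℕ.^ (s ℕ.* 6)      ≡⟨ ℕ.^-distribˡ-+-* 2 (s ℕ.* 7) (s ℕ.* 6) ⟨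
        2 ℕ.^ (s ℕ.* 7 ℕ.+ s ℕ.* 6)              ≡⟨ cong (2 ℕ.^_) (ℕ.*-distribˡ-+ s 7 6) ⟨
        2 ℕ.^ (s ℕ.* 13)                         <⟨ exponents (ℕ.≤ᵇ⇒≤ 14 16 _) ⟩
        2 ℕ.^ (s ℕ.* 16)                         ∎)
  in G , independent , u , far
  where open ℕ.≤-Reasoning

-- The code is linear, so the difference of a point of the coset and a codeword is
-- again a point of the coset.
coset-far : ∀ {r m t} (G : Vec (Cube r) m) u → (∀ y → t ℕ.< weight (encode G y ⊕ u)) →
            ∀ y z → t ℕ.< weight ((encode G y ⊕ u) ⊕ encode G z)
coset-far {t = t} G u far y z = subst (λ v → t ℕ.< weight v) eq (far (y ⊕ z))
  where
  open ≡-Reasoning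
  eq : encode G (y ⊕ z) ⊕ u ≡ (encode G y ⊕ u) ⊕ encode G z
  eq = begin
    encode G (y ⊕ z) ⊕ u            ≡⟨ cong (_⊕ u) (encode-⊕ G y z) ⟩
    encode G y ⊕ encode G z ⊕ u     ≡⟨ ⊕-assoc (encode G y) (encode G z) u ⟩
    encode G y ⊕ (encode G z ⊕ u)   ≡⟨ cong (encode G y ⊕_) (⊕-comm (encode G z) u) ⟩
    encode G y ⊕ (u ⊕ encode G z)   ≡⟨ ⊕-assoc (encode G y) u (encode G z) ⟨
    encode G y ⊕ u ⊕ encode G z     ∎

-- The threshold 640 is 20 times 32: with s = n / 32 at least 20, the additive 10 in
-- the bound s < 3 q + 10 is absorbed into s + 1 ≤ 12 q, and n < 32 (s + 1).
Hard : ℕ → Set₁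
Hard n = Σ (Property n) λ P → 640 ℕ.≤ n → ∀ q (T : AdaptiveAlgorithm n q) →
         IsAdaptiveTester P (fromℚ 1/96) ⅓ℝ T → n ℕ.≤ q ℕ.* 384

-- The code is an argument, so that its greedy construction is never unfolded.
fromCode : ∀ s′ L → L ℕ.< 32 → HardCode (suc s′) → Hard (suc s′ ℕ.* 16 ℕ.* 2 ℕ.+ L)
fromCode s′ L L<32 (G , independent , u , far) = P , bound
  where
  s n : ℕ
  s = suc s′
  n = s ℕ.* 16 ℕ.* 2 ℕ.+ L
  code coset : Cube (s ℕ.* 7) → Cube (s ℕ.* 16)
  code  y = encode G y
  coset y = encode G y ⊕ u
  P : Property n
  P = farFrom (fromℚ 1/96) (λ y → encoded (coset y))
  n<[1+s]*32 : n ℕ.< suc s ℕ.* 32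
  n<[1+s]*32 = begin-strict
    s ℕ.* 16 ℕ.* 2 ℕ.+ L   ≡⟨ cong (ℕ._+ L) (ℕ.*-assoc s 16 2) ⟩
    s ℕ.* 32 ℕ.+ L         <⟨ ℕ.+-monoʳ-< (s ℕ.* 32) L<32 ⟩
    s ℕ.* 32 ℕ.+ 32        ≡⟨ ℕ.+-comm (s ℕ.* 32) 32 ⟩
    suc s ℕ.* 32           ∎
    where open ℕ.≤-Reasoning
  n≤s*64 : n ℕ.≤ s ℕ.* 64
  n≤s*64 = begin
    n                      ≤⟨ ℕ.<⇒≤ n<[1+s]*32 ⟩
    suc s ℕ.* 32           ≤⟨ ℕ.*-monoˡ-≤ 32 (ℕ.≤-trans (ℕ.+-monoˡ-≤ s (s≤s (z≤n {s′})))
                                                (ℕ.≤-reflexive s+s≡s*2)) ⟩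
    s ℕ.* 2 ℕ.* 32         ≡⟨ ℕ.*-assoc s 2 32 ⟩
    s ℕ.* 64               ∎
    where
    open ℕ.≤-Reasoning
    s+s≡s*2 : s ℕ.+ s ≡ s ℕ.* 2
    s+s≡s*2 = trans (cong (s ℕ.+_) (sym (ℕ.+-identityʳ s))) (ℕ.*-comm 2 s)
  inside : ∀ y → holds P (encoded (code y))
  inside y z = encoded-far {L = L} {t = s} (coset z) (code y) n≤s*64
    (ℕ.<⇒≤ (coset-far G u far z y))
  bound : 640 ℕ.≤ n → ∀ q (T : AdaptiveAlgorithm n q) →
          IsAdaptiveTester P (fromℚ 1/96) ⅓ℝ T → n ℕ.≤ q ℕ.* 384
  bound 640≤n q T tester = begin
    n                      ≤⟨ ℕ.<⇒≤ n<[1+s]*32 ⟩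
    suc s ℕ.* 32           ≤⟨ ℕ.*-monoˡ-≤ 32 1+s≤12q ⟩
    q ℕ.* 12 ℕ.* 32        ≡⟨ ℕ.*-assoc q 12 32 ⟩
    q ℕ.* 384              ∎
    where
    open ℕ.≤-Reasoning
    open ℕ.+-*-Solver
    s<3q+10 : s ℕ.< q ℕ.* 3 ℕ.+ 10
    s<3q+10 = tester-needs-samples {L = L} {ε = fromℚ 1/96} code coset
      (code-coset G independent u) P inside (λ y μ′ farFromCoset → farFromCoset y) T tester
    20≤s : 20 ℕ.≤ s
    20≤s = ℕ.≤-pred (ℕ.*-cancelʳ-< 32 20 (suc s) (ℕ.≤-<-trans 640≤n n<[1+s]*32))
    1+s≤12q : suc s ℕ.≤ q ℕ.* 12
    1+s≤12q = ℕ.+-cancelʳ-≤ 40 (suc s) (q ℕ.* 12) (begin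
      suc s ℕ.+ 40              ≤⟨ ℕ.+-monoʳ-≤ (suc s) (ℕ.*-monoʳ-≤ 2 20≤s) ⟩
      suc s ℕ.+ 2 ℕ.* s         ≤⟨ ℕ.m≤m+n (suc s ℕ.+ 2 ℕ.* s) (3 ℕ.+ s) ⟩
      suc s ℕ.+ 2 ℕ.* s ℕ.+ (3 ℕ.+ s)
        ≡⟨ solve 1 (λ s → con 1 :+ s :+ con 2 :* s :+ (con 3 :+ s) := con 4 :* (con 1 :+ s)) refl s ⟩
      4 ℕ.* suc s               ≤⟨ ℕ.*-monoʳ-≤ 4 s<3q+10 ⟩
      4 ℕ.* (q ℕ.* 3 ℕ.+ 10)    ≡⟨ solve 1 (λ q → con 4 :* (q :* con 3 :+ con 10) := q :* con 12 :+ con 40) refl q ⟩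
      q ℕ.* 12 ℕ.+ 40           ∎)

hardPadded : ∀ s L → L ℕ.< 32 → Hard (s ℕ.* 16 ℕ.* 2 ℕ.+ L)
-- Here the domain is smaller than the threshold, and any property serves.
hardPadded zero L L<32 =
  record { holds = λ _ → ⊤ ; respects = λ _ _ → tt } ,
  λ 640≤L → contradiction (ℕ.≤-trans L<32 (ℕ.≤-trans (ℕ.≤ᵇ⇒≤ 32 640 _) 640≤L)) (ℕ.<-irrefl refl)
hardPadded (suc s′) L L<32 = fromCode s′ L L<32 (hardCode s′)

hard : ∀ n → Hard n
hard n = subst Hard split (hardPadded (n ℕ./ 32) (n ℕ.% 32) (ℕ.m%n<n n 32))
  where
  open ≡-Reasoning
  split : n ℕ./ 32 ℕ.* 16 ℕ.* 2 ℕ.+ n ℕ.% 32 ≡ n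
  split = begin
    n ℕ./ 32 ℕ.* 16 ℕ.* 2 ℕ.+ n ℕ.% 32   ≡⟨ cong (ℕ._+ n ℕ.% 32) (ℕ.*-assoc (n ℕ./ 32) 16 2) ⟩
    n ℕ./ 32 ℕ.* 32 ℕ.+ n ℕ.% 32         ≡⟨ ℕ.+-comm (n ℕ./ 32 ℕ.* 32) (n ℕ.% 32) ⟩
    n ℕ.% 32 ℕ.+ n ℕ./ 32 ℕ.* 32         ≡⟨ ℕ.m≡m%n+[m/n]*n n 32 ⟨
    n                                    ∎

1/384 : ℚ
1/384 = ℤ.+ 1 ℚ./ 384

scaled-≤ : ∀ n q → n ℕ.≤ q ℕ.* 384 → fromℚ 1/384 * fromℕ n ≤ fromℕ q
scaled-≤ n q n≤384q = pointwise-≤ {fromℚ 1/384 * fromℕ n} {fromℕ q} λ _ → begin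
  1/384 ℚ.* ι n                ≤⟨ *-monoˡ-≤ {1/384} (ℚ.nonNegative⁻¹ 1/384) (ι-mono n≤384q) ⟩
  1/384 ℚ.* ι (q ℕ.* 384)      ≡⟨ cong (1/384 ℚ.*_) (ι-* q 384) ⟩
  1/384 ℚ.* (ι q ℚ.* ι 384)    ≡⟨ solve 1 (λ q → con 1/384 :* (q :* con (ι 384)) := q) refl (ι q) ⟩
  ι q                          ∎
  where open ℚ.≤-Reasoning
        open ℚ.+-*-Solver

0<fromℚ : ∀ {p} → 0ℚ ℚ.< p → 0ℝ < fromℚ p
0<fromℚ {p} 0<p = p , 0<p , 0 , λ _ _ → ℚ.≤-reflexive (ℚ.+-identityˡ p)

theorem8p0p1 : Σ ℝ λ ε → Σ ℝ λ c → 0ℝ < ε × 0ℝ < c ×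
    Σ ((n : ℕ) → Property n) λ P →
    Σ ℕ λ n₀ → (n : ℕ) → n₀ ℕ.≤ n → (q : ℕ) →
    ((T : AdaptiveAlgorithm n q) →
    IsAdaptiveTester (P n) ε ⅓ℝ T → c * fromℕ n ≤ fromℕ q)
    ×
    ((T : NonAdaptiveAlgorithm n q) →
    IsNonAdaptiveTester (P n) ε ⅓ℝ T → c * fromℕ n ≤ fromℕ q)
theorem8p0p1 =
  fromℚ 1/96 , fromℚ 1/384 , 0<fromℚ (ℚ.positive⁻¹ 1/96) , 0<fromℚ (ℚ.positive⁻¹ 1/384) ,
  (λ n → proj₁ (hard n)) , 640 , λ n 640≤n q →
    let bound = λ T tester → scaled-≤ n q (proj₂ (hard n) 640≤n q T tester)
    in bound , λ T → bound (toAdaptive T)
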